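{- Let $n,r\in\mathbb{N}$ and write $n=a(r+1)+b$ with integers $a\ge 0$ and $0\le b\le r$. If $G$ is a graph on $n$ vertices with maximum degree $\Delta(G)\le r$, then \[ k(G)\le k(aK_{r+1}\cup K_b), \] with equality if and only if $G$ is isomorphic to $aK_{r+1}\cup K_b$, or $r=2$ and $G$ is isomorphic to $(a-1)K_3\cup C_4$ or to $(a-1)K_3\cup C_5$.
   Context: All graphs are finite and simple. A clique of $G$ is a set of vertices inducing a complete subgraph (not necessarily maximal); the empty set counts as a clique. $k(G)$ denotes the number of cliques of $G$ (including the empty one). $aK_{r+1}\cup K_b$ denotes the disjoint union of $a$ copies of the complete graph $K_{r+1}$ and one copy of $K_b$ (with $K_0$ the empty graph); $C_m$ is the cycle on $m$ vertices. -}

module Defs where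

open import Data.Nat using (ℕ; zero; suc; _+_; _*_; _%_; _≡ᵇ_)
open import Data.Bool using (Bool; true; false; not; _∧_; _∨_)
open import Data.Bool.Properties using (∨-comm)
open import Data.Fin using (Fin; toℕ; splitAt; _≟_)
open import Data.Fin.Properties using (all?)
open import Data.Fin.Subset using (Subset; _∈_; ∣_∣; inside; outside)
open import Data.Fin.Subset.Properties using (_∈?_)
open import Data.Sum using (_⊎_; inj₁; inj₂)
open import Data.Vec using (Vec; []; _∷_; tabulate)
open import Data.List using (List; []; _∷_; _++_; map; filter; length)
open import Data.Product using (Σ)
open import Function.Bundles using (Bijection)
open import Relation.Nullary using (Dec; yes; no; ¬_; _→-dec_)
open import Relation.Nullary.Decidable using (⌊_⌋)
open import Relation.Binary.PropositionalEquality using (_≡_; _≢_; refl; cong; cong₂) renaming (sym to ≡-sym)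
open import Data.Empty using (⊥-elim)

record Graph (n : ℕ) : Set where
  field
    adj    : Fin n → Fin n → Bool
    sym    : ∀ i j → adj i j ≡ adj j i
    irrefl : ∀ i → adj i i ≡ false
open Graph public

degree : ∀ {n} → Graph n → Fin n → ℕ
degree G i = ∣ tabulate (adj G i) ∣

MaxDegree≤ : ∀ {n} → Graph n → ℕ → Set
MaxDegree≤ G r = ∀ i → degree G i Data.Nat.≤ r

-- Cliques: subsets inducing a complete subgraph (the empty set included).
IsClique : ∀ {n} → Graph n → Subset n → Set
IsClique G s = ∀ i j → i ∈ s → j ∈ s → i ≢ j → adj G i j ≡ true

private
  bool≡? : (x : Bool) → Dec (x ≡ true)
  bool≡? true  = yes refl
  bool≡? false = no (λ ())

  ≢? : ∀ {n} (i j : Fin n) → Dec (i ≢ j)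
  ≢? i j with i ≟ j
  ... | yes p = no (λ q → q p)
  ... | no p  = yes p

isClique? : ∀ {n} (G : Graph n) (s : Subset n) → Dec (IsClique G s)
isClique? G s = all? λ i → all? λ j →
  (i ∈? s) →-dec ((j ∈? s) →-dec (≢? i j →-dec bool≡? (adj G i j)))

allSubsets : (n : ℕ) → List (Subset n)
allSubsets zero    = [] ∷ []
allSubsets (suc n) = map (inside ∷_) (allSubsets n) ++ map (outside ∷_) (allSubsets n)

-- k(G): the number of cliques of G (including the empty one).
k : ∀ {n} → Graph n → ℕ
k {n} G = length (filter (isClique? G) (allSubsets n))

_≅_ : ∀ {m n} → Graph m → Graph n → Set
_≅_ {m} {n} G H = Σ (Bijection (≡-setoid (Fin m)) (≡-setoid (Fin n)))
    λ f → ∀ i j → adj H (Bijection.to f i) (Bijection.to f j) ≡ adj G i j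
  where open import Relation.Binary.PropositionalEquality using () renaming (setoid to ≡-setoid)

K₀ : Graph 0
K₀ = record { adj = λ () ; sym = λ () ; irrefl = λ () }

private
  neq : ∀ {n} → Fin n → Fin n → Bool
  neq i j = not ⌊ i ≟ j ⌋

  neq-sym : ∀ {n} (i j : Fin n) → neq i j ≡ neq j i
  neq-sym i j with i ≟ j | j ≟ i
  ... | yes _ | yes _ = refl
  ... | no _  | no _  = refl
  ... | yes p | no q  = ⊥-elim (q (≡-sym p))
  ... | no p  | yes q = ⊥-elim (p (≡-sym q))

  neq-irr : ∀ {n} (i : Fin n) → neq i i ≡ false
  neq-irr i with i ≟ i
  ... | yes _ = refl
  ... | no p  = ⊥-elim (p refl)

simpleFrom : ∀ {n} → (Fin n → Fin n → Bool) → Graph n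
simpleFrom R = record
  { adj = λ i j → neq i j ∧ (R i j ∨ R j i)
  ; sym = λ i j → cong₂ _∧_ (neq-sym i j) (∨-comm (R i j) (R j i))
  ; irrefl = λ i → cong (_∧ (R i i ∨ R i i)) (neq-irr i)
  }

K : (m : ℕ) → Graph m
K m = simpleFrom (λ _ _ → true)

-- Cycle C_m (meaningful for m ≥ 3): i ~ j iff j ≡ i + 1 (mod m) or i ≡ j + 1 (mod m).
C : (m : ℕ) → Graph m
C zero    = K₀
C (suc m) = simpleFrom (λ i j → (suc (toℕ i) % suc m) ≡ᵇ toℕ j)

_∪G_ : ∀ {m n} → Graph m → Graph n → Graph (m + n)
_∪G_ {m} {n} G H = record { adj = a ; sym = s ; irrefl = ir }
  where
  a' : Fin m ⊎ Fin n → Fin m ⊎ Fin n → Bool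
  a' (inj₁ x) (inj₁ y) = adj G x y
  a' (inj₂ x) (inj₂ y) = adj H x y
  a' _        _        = false
  a : Fin (m + n) → Fin (m + n) → Bool
  a i j = a' (splitAt m i) (splitAt m j)
  s' : ∀ x y → a' x y ≡ a' y x
  s' (inj₁ x) (inj₁ y) = sym G x y
  s' (inj₁ x) (inj₂ y) = refl
  s' (inj₂ x) (inj₁ y) = refl
  s' (inj₂ x) (inj₂ y) = sym H x y
  s : ∀ i j → a i j ≡ a j i
  s i j = s' (splitAt m i) (splitAt m j)
  ir' : ∀ x → a' x x ≡ false
  ir' (inj₁ x) = irrefl G x
  ir' (inj₂ x) = irrefl H x
  ir : ∀ i → a i i ≡ false
  ir i = ir' (splitAt m i)

copies : ∀ {m} (a : ℕ) → Graph m → Graph (a * m)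
copies zero    G = K₀
copies (suc a) G = G ∪G copies a G

{-# OPTIONS --safe #-}
module Submission where

-- For a vertex v of degree d let p(v) be the number of cliques avoiding v that meet N(v) without
-- lying inside it, and q(v) the number of subsets of N(v) that are not cliques.  Sorting cliques
-- by how they meet N[v] gives k(G) + 1 + 2 q(v) = k(G - N[v]) + p(v) + 2^(d+1).
-- Moreover Σ p ≤ 2 Σ q: send (z , T), counted by p(z), to (v , T + z - v) for some v ∈ T ∩ N(z);
-- given (v , U), the vertex z must be an end of every non-edge inside U, so there are at most two
-- choices for it.  Hence p(v) ≤ 2 q(v) for some v, and since 2^x + 2^y only grows when x and y
-- are pushed apart with x + y fixed, deleting N[v] and induction on n give the bound.
-- In an extremal graph p(v) = 2 q(v) for every v, so every vertex may be the one deleted, whence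
-- d = r or d + 1 = b; and the double count is tight, which forces the neighbourhood of every vertex
-- of degree at least 3 to be a clique.  So a component K_{r+1} splits off, unless the graph is
-- 2-regular and triangle-free with r = 2, when it is C₄ or C₅.

open import Defs
open import Data.Bool using (Bool; true; false; not)
import Data.Bool.Properties as Bool
open import Data.Fin using (Fin; zero; suc; toℕ; cast; punchOut; splitAt; _↑ˡ_; _↑ʳ_; _≟_)
open import Data.Fin.Properties using (all?; any?; injective⇒≤; punchOut-injective; splitAt-↑ˡ; splitAt-↑ʳ; splitAt⁻¹-↑ˡ; splitAt⁻¹-↑ʳ; suc-injective; toℕ-cast; toℕ-injective; ↑ˡ-injective; ↑ʳ-injective)
open import Data.Fin.Subset using (Subset; _∈_; _∉_; _⊆_; ⊤; ⊥; ∁; ∣_∣; inside; outside)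
open import Data.Fin.Subset.Properties using (_∈?_; _⊆?_; drop-∷-⊆; nonempty?; out⊆; s⊆s; x∈p⇒x∉∁p; x∈∁p⇒x∉p; x∉p⇒x∈∁p; ∈⊤; ∉⊥; ∣p∣≤n; ∣∁p∣≡n∸∣p∣; ∣⊤∣≡n; ∣⊥∣≡0)
open import Data.List using (List; []; _∷_; _++_; allFin; filter; length; map)
import Data.List.Membership.DecPropositional as DecMem
import Data.List.Membership.Propositional as Mem
open import Data.List.Membership.Propositional.Properties using (∈-allFin; ∈-map⁺; ∈-++⁺ˡ; ∈-++⁺ʳ)
open import Data.List.Properties using (map-tabulate)
open import Data.List.Relation.Unary.All as All using (All; []; _∷_)
open import Data.List.Relation.Unary.AllPairs using (AllPairs; []; _∷_)
open import Data.List.Relation.Unary.Any using (here; there)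
open import Data.List.Relation.Unary.Unique.Propositional using (Unique)
open import Data.Nat as ℕ using (ℕ; zero; suc; _+_; _*_; _∸_; _^_; _≤_; _<_; z≤n; s≤s)
open import Data.Nat.Induction using (<-rec)
open import Data.Nat.Properties hiding (_≟_) renaming (suc-injective to ℕ-suc-injective)
open import Data.Nat.Solver using (module +-*-Solver)
open import Data.Product using (∃; _×_; _,_; proj₁; proj₂)
open import Data.Sum using (_⊎_; inj₁; inj₂; [_,_]′)
open import Data.Vec as Vec using ([]; _∷_; lookup; tabulate; updateAt) renaming (here to here[]=; there to there[]=)
open import Data.Vec.Properties using ([]=⇒lookup; lookup⇒[]=; lookup∘tabulate; lookup∘updateAt; lookup∘updateAt′; lookup-++ˡ; lookup-++ʳ; tabulate∘lookup; tabulate-cong; ≡-dec; ∷-injectiveˡ; ∷-injectiveʳ)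
open import Function using (_∘_; case_of_; id)
open import Function.Bundles using (Bijection; _⇔_; mk⇔; mk⤖)
open import Relation.Binary.PropositionalEquality using (_≡_; _≢_; refl; trans; cong; cong₂; subst; subst₂; module ≡-Reasoning) renaming (sym to ≡-sym)
open import Relation.Nullary using (Dec; yes; no; ¬_; ¬?; does; _×-dec_; _→-dec_; contradiction)
open import Relation.Nullary.Decidable using (dec-true)
open +-*-Solver using (solve; _:=_; _:+_; _:*_; con)

-- The identity for k(G) is a statement about replacement: the disjoint union of K_{d+1} and G -
-- N[v] has k(G - N[v]) + 2^(d+1) - 1 cliques, so turning N[v] into a clique component changes the
-- count by exactly 2 q(v) - p(v). The obstacle is that a given vertex may lose cliques in this way:
-- at an end of a path on three vertices q = 0 and p = 1. Only the sum over all vertices is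
-- controlled, which is why the bound needs an averaging argument, and why in the equality case
-- averaging has to be used a second time, to show that no vertex has p > 2 q. The convexity step is
-- the inequality (2^x - 1)(2^y - 1) ≥ 0, whose equality case x = 0 or y = 0 leaves just two
-- possible degrees in an extremal graph. Subtraction is avoided throughout: clique numbers are
-- compared in the form k(G) + a, because each of the a unions in `copies a (K (suc r)) ∪G K b`
-- shares one empty clique.

private
  variable
    A B : Set
    m n p q : ℕ

-- Finite sums and indicators

infix 5 ∑
∑ : List A → (A → ℕ) → ℕ
∑ []       f = 0
∑ (x ∷ xs) f = f x + ∑ xs f

∑-cong : (xs : List A) {f g : A → ℕ} → (∀ x → f x ≡ g x) → ∑ xs f ≡ ∑ xs g
∑-cong []       h = refl
∑-cong (x ∷ xs) h = cong₂ _+_ (h x) (∑-cong xs h)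

∑-mono : (xs : List A) {f g : A → ℕ} → (∀ x → f x ≤ g x) → ∑ xs f ≤ ∑ xs g
∑-mono []       h = z≤n
∑-mono (x ∷ xs) h = +-mono-≤ (h x) (∑-mono xs h)

∑-mono-< : {xs : List A} {f g : A → ℕ} {x : A} → (∀ y → f y ≤ g y) →
  x Mem.∈ xs → f x < g x → ∑ xs f < ∑ xs g
∑-mono-< {xs = _ ∷ xs} h (here refl) l = +-mono-<-≤ l (∑-mono xs h)
∑-mono-< {xs = y ∷ _}  h (there e)   l = +-mono-≤-< (h y) (∑-mono-< h e l)

+-interchange : ∀ a b c d → (a + b) + (c + d) ≡ (a + c) + (b + d)
+-interchange = solve 4 (λ a b c d → (a :+ b) :+ (c :+ d) := (a :+ c) :+ (b :+ d)) refl

∑-+ : (xs : List A) (f g : A → ℕ) → ∑ xs (λ x → f x + g x) ≡ ∑ xs f + ∑ xs g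
∑-+ []       f g = refl
∑-+ (x ∷ xs) f g = trans (cong (f x + g x +_) (∑-+ xs f g)) (+-interchange (f x) (g x) (∑ xs f) (∑ xs g))

∑-zero : (xs : List A) → ∑ xs (λ _ → 0) ≡ 0
∑-zero []       = refl
∑-zero (x ∷ xs) = ∑-zero xs

∑-swap : (xs : List A) (ys : List B) (f : A → B → ℕ) →
  ∑ xs (λ x → ∑ ys (f x)) ≡ ∑ ys (λ y → ∑ xs (λ x → f x y))
∑-swap []       ys f = ≡-sym (∑-zero ys)
∑-swap (x ∷ xs) ys f = trans (cong (∑ ys (f x) +_) (∑-swap xs ys f))
  (≡-sym (∑-+ ys (f x) (λ y → ∑ xs (λ x′ → f x′ y))))

∑-++ : (xs ys : List A) (f : A → ℕ) → ∑ (xs ++ ys) f ≡ ∑ xs f + ∑ ys f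
∑-++ []       ys f = refl
∑-++ (x ∷ xs) ys f = trans (cong (f x +_) (∑-++ xs ys f)) (≡-sym (+-assoc (f x) _ _))

∑-map : (g : A → B) (xs : List A) (f : B → ℕ) → ∑ (map g xs) f ≡ ∑ xs (f ∘ g)
∑-map g []       f = refl
∑-map g (x ∷ xs) f = cong (f (g x) +_) (∑-map g xs f)

∑-allFin-suc : (f : Fin (suc n) → ℕ) → ∑ (allFin (suc n)) f ≡ f zero + ∑ (allFin n) (f ∘ suc)
∑-allFin-suc f = cong (f zero +_)
  (trans (cong (λ xs → ∑ xs f) (≡-sym (map-tabulate id suc))) (∑-map suc (allFin _) f))

∑-one : ∀ n → ∑ (allFin n) (λ _ → 1) ≡ n
∑-one zero    = refl
∑-one (suc n) = trans (∑-allFin-suc {n} (λ _ → 1)) (cong suc (∑-one n))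

∑-allSubsets-suc : (f : Subset (suc n) → ℕ) →
  ∑ (allSubsets (suc n)) f ≡ ∑ (allSubsets n) (f ∘ (inside ∷_)) + ∑ (allSubsets n) (f ∘ (outside ∷_))
∑-allSubsets-suc {n} f = trans (∑-++ (map (inside ∷_) (allSubsets n)) _ f)
  (cong₂ _+_ (∑-map (inside ∷_) (allSubsets n) f) (∑-map (outside ∷_) (allSubsets n) f))

∈-allSubsets : (S : Subset n) → S Mem.∈ allSubsets n
∈-allSubsets []            = here refl
∈-allSubsets (inside  ∷ S) = ∈-++⁺ˡ (∈-map⁺ (inside ∷_) (∈-allSubsets S))
∈-allSubsets (outside ∷ S) = ∈-++⁺ʳ (map (inside ∷_) (allSubsets _)) (∈-map⁺ (outside ∷_) (∈-allSubsets S))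

⟦_⟧ᵇ : Bool → ℕ
⟦ true  ⟧ᵇ = 1
⟦ false ⟧ᵇ = 0

⟦_⟧ : Dec A → ℕ
⟦ d ⟧ = ⟦ does d ⟧ᵇ

⟦⟧-yes : (d : Dec A) → A → ⟦ d ⟧ ≡ 1
⟦⟧-yes (yes _) a = refl
⟦⟧-yes (no ¬a) a = contradiction a ¬a

⟦⟧-no : (d : Dec A) → ¬ A → ⟦ d ⟧ ≡ 0
⟦⟧-no (yes a) ¬a = contradiction a ¬a
⟦⟧-no (no _)  ¬a = refl

⟦⟧≤1 : (d : Dec A) → ⟦ d ⟧ ≤ 1
⟦⟧≤1 (yes _) = s≤s z≤n
⟦⟧≤1 (no _)  = z≤n

⟦⟧-≤ : (d : Dec A) {m : ℕ} → (A → 1 ≤ m) → ⟦ d ⟧ ≤ m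
⟦⟧-≤ (yes a) h = h a
⟦⟧-≤ (no _)  h = z≤n

⟦⟧-mono : (d : Dec A) (e : Dec B) → (A → B) → ⟦ d ⟧ ≤ ⟦ e ⟧
⟦⟧-mono d e h = ⟦⟧-≤ d (λ a → ≤-reflexive (≡-sym (⟦⟧-yes e (h a))))

⟦⟧-cong : (d : Dec A) (e : Dec B) → (A → B) → (B → A) → ⟦ d ⟧ ≡ ⟦ e ⟧
⟦⟧-cong d e f g = ≤-antisym (⟦⟧-mono d e f) (⟦⟧-mono e d g)

length-filter : {P : A → Set} (P? : ∀ x → Dec (P x)) (xs : List A) →
  length (filter P? xs) ≡ ∑ xs (λ x → ⟦ P? x ⟧)
length-filter P? []       = refl
length-filter P? (x ∷ xs) with P? x
... | yes _ = cong suc (length-filter P? xs)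
... | no _  = length-filter P? xs

∑-≟ : (i : Fin n) → ∑ (allFin n) (λ j → ⟦ j ≟ i ⟧) ≡ 1
∑-≟ {suc n} zero = trans (∑-allFin-suc {n} (λ j → ⟦ j ≟ zero ⟧))
  (cong suc (trans (∑-cong (allFin n) λ j → ⟦⟧-no (suc j ≟ zero) λ ()) (∑-zero (allFin n))))
∑-≟ {suc n} (suc i) = trans (∑-allFin-suc {n} (λ j → ⟦ j ≟ suc i ⟧))
  (trans (cong (_+ ∑ (allFin n) (λ j → ⟦ suc j ≟ suc i ⟧)) (⟦⟧-no (zero ≟ suc i) λ ()))
    (trans (∑-cong (allFin n) λ j → ⟦⟧-cong (suc j ≟ suc i) (j ≟ i) suc-injective (cong suc)) (∑-≟ i)))

≤∑ : {xs : List A} (f : A → ℕ) {x : A} → x Mem.∈ xs → f x ≤ ∑ xs f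
≤∑ {xs = _ ∷ xs} f (here refl) = m≤m+n _ _
≤∑ {xs = y ∷ _}  f (there e)   = ≤-trans (≤∑ f e) (m≤n+m _ (f y))

-- Subsets: toggling an element, cardinality, subsets of a given set

toggle : Fin n → Subset n → Subset n
toggle i S = updateAt S i not

-- Toggling `i` permutes the subsets, exchanging those with `i` and those without. This is the
-- change of variables behind both bijective counts: exchanging `v` for `z`, and adding `v` to a
-- clique inside N(v).
∑-toggle : (i : Fin n) (f : Subset n → ℕ) → ∑ (allSubsets n) (f ∘ toggle i) ≡ ∑ (allSubsets n) f
∑-toggle zero f = trans (∑-allSubsets-suc (f ∘ toggle zero))
  (trans (+-comm (∑ (allSubsets _) (f ∘ (outside ∷_))) _) (≡-sym (∑-allSubsets-suc f)))
∑-toggle (suc i) f = trans (∑-allSubsets-suc (f ∘ toggle (suc i)))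
  (trans (cong₂ _+_ (∑-toggle i (f ∘ (inside ∷_))) (∑-toggle i (f ∘ (outside ∷_)))) (≡-sym (∑-allSubsets-suc f)))

∈-toggle⁺ : {i j : Fin n} {S : Subset n} → j ≢ i → j ∈ S → j ∈ toggle i S
∈-toggle⁺ {i = i} {j} {S} ne e = lookup⇒[]= j _ (trans (lookup∘updateAt′ j i ne S) ([]=⇒lookup e))

∈-toggle⁻ : {i j : Fin n} {S : Subset n} → j ≢ i → j ∈ toggle i S → j ∈ S
∈-toggle⁻ {i = i} {j} {S} ne e = lookup⇒[]= j _ (trans (≡-sym (lookup∘updateAt′ j i ne S)) ([]=⇒lookup e))

∈-toggle-self⁺ : {i : Fin n} {S : Subset n} → i ∉ S → i ∈ toggle i S
∈-toggle-self⁺ {i = i} {S} ni = lookup⇒[]= i _ (trans (lookup∘updateAt i S) (lem (lookup S i) refl))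
  where
  lem : ∀ b → lookup S i ≡ b → not b ≡ true
  lem false _ = refl
  lem true  e = contradiction (lookup⇒[]= i S e) ni

∈-toggle-self⁻ : {i : Fin n} {S : Subset n} → i ∈ toggle i S → i ∉ S
∈-toggle-self⁻ {i = i} {S} e e′ with trans (≡-sym (lookup∘updateAt i S)) ([]=⇒lookup e)
... | q rewrite []=⇒lookup e′ = case q of λ ()

∈-tabulate⁺ : {f : Fin n → Bool} {i : Fin n} → f i ≡ true → i ∈ tabulate f
∈-tabulate⁺ {f = f} {i} e = lookup⇒[]= i _ (trans (lookup∘tabulate f i) e)

∈-tabulate⁻ : {f : Fin n → Bool} {i : Fin n} → i ∈ tabulate f → f i ≡ true
∈-tabulate⁻ {f = f} {i} e = trans (≡-sym (lookup∘tabulate f i)) ([]=⇒lookup e)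

∣∣-∑ : (W : Subset n) → ∣ W ∣ ≡ ∑ (allFin n) (λ i → ⟦ i ∈? W ⟧)
∣∣-∑ []      = refl
∣∣-∑ (inside ∷ W) = ≡-sym (trans (∑-allFin-suc (λ i → ⟦ i ∈? (inside ∷ W) ⟧))
   (cong suc (trans (∑-cong (allFin _) λ i → ⟦⟧-cong (suc i ∈? (inside ∷ W)) (i ∈? W) (λ { (there[]= e) → e }) there[]=) (≡-sym (∣∣-∑ W)))))
∣∣-∑ (outside ∷ W) = ≡-sym (trans (∑-allFin-suc (λ i → ⟦ i ∈? (outside ∷ W) ⟧))
   (trans (∑-cong (allFin _) λ i → ⟦⟧-cong (suc i ∈? (outside ∷ W)) (i ∈? W) (λ { (there[]= e) → e }) there[]=) (≡-sym (∣∣-∑ W))))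

∑-⊆ : (W : Subset n) → ∑ (allSubsets n) (λ S → ⟦ S ⊆? W ⟧) ≡ 2 ^ ∣ W ∣
∑-⊆ [] = refl
∑-⊆ {suc n} (inside ∷ W) = trans (∑-allSubsets-suc {n} (λ S → ⟦ S ⊆? (inside ∷ W) ⟧))
  (cong₂ _+_
    (trans (∑-cong (allSubsets n) λ S → ⟦⟧-cong ((inside ∷ S) ⊆? (inside ∷ W)) (S ⊆? W) drop-∷-⊆ s⊆s) (∑-⊆ W))
    (trans (trans (∑-cong (allSubsets n) λ S → ⟦⟧-cong ((outside ∷ S) ⊆? (inside ∷ W)) (S ⊆? W) drop-∷-⊆ out⊆) (∑-⊆ W))
      (≡-sym (+-identityʳ _))))
∑-⊆ {suc n} (outside ∷ W) = trans (∑-allSubsets-suc {n} (λ S → ⟦ S ⊆? (outside ∷ W) ⟧))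
  (cong₂ _+_
    (trans (∑-cong (allSubsets n) λ S → ⟦⟧-no ((inside ∷ S) ⊆? (outside ∷ W)) (λ h → case h here[]= of λ ()))
      (∑-zero (allSubsets n)))
    (trans (∑-cong (allSubsets n) λ S → ⟦⟧-cong ((outside ∷ S) ⊆? (outside ∷ W)) (S ⊆? W) drop-∷-⊆ s⊆s) (∑-⊆ W)))

abstract
  fromList : ∀ {n} → List (Fin n) → Subset n
  fromList L = tabulate (λ i → does (DecMem._∈?_ _≟_ i L))

  ∈-fromList⁺ : ∀ {n} {L : List (Fin n)} {i} → i Mem.∈ L → i ∈ fromList L
  ∈-fromList⁺ {L = L} {i} e = ∈-tabulate⁺ (dec-true (DecMem._∈?_ _≟_ i L) e)

  ∈-fromList⁻ : ∀ {n} {L : List (Fin n)} {i} → i ∈ fromList L → i Mem.∈ L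
  ∈-fromList⁻ {L = L} {i} e
    with DecMem._∈?_ _≟_ i L | ∈-tabulate⁻ {f = λ j → does (DecMem._∈?_ _≟_ j L)} e
  ... | yes p | _ = p

allPairs⇒ : {A : Set} {R : A → A → Set} {L : List A} → (∀ {x y} → R x y → R y x) → AllPairs R L →
  ∀ {x y} → x Mem.∈ L → y Mem.∈ L → x ≢ y → R x y
allPairs⇒ s (a ∷ h) (here refl) (here refl) ne = contradiction refl ne
allPairs⇒ s (a ∷ h) (here refl) (there q)   ne = All.lookup a q
allPairs⇒ s (a ∷ h) (there p)   (here refl) ne = s (All.lookup a p)
allPairs⇒ s (a ∷ h) (there p)   (there q)   ne = allPairs⇒ s h p q ne

-- Double counting straddling cliques

module _ {n : ℕ} (G : Graph n) where

  N : Fin n → Subset n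
  N v = tabulate (adj G v)

  adj? : (i j : Fin n) → Dec (adj G i j ≡ true)
  adj? i j = adj G i j Bool.≟ true

  adj-comm : ∀ {i j} → adj G i j ≡ true → adj G j i ≡ true
  adj-comm {i} {j} = trans (sym G j i)

  adj⇒≢ : ∀ {i j} → adj G i j ≡ true → i ≢ j
  adj⇒≢ {i} e refl = case trans (≡-sym e) (irrefl G i) of λ ()

  clique-fromList : ∀ {L} → AllPairs (λ i j → adj G i j ≡ true) L → IsClique G (fromList L)
  clique-fromList {L} h i j i∈ j∈ = allPairs⇒ adj-comm h (∈-fromList⁻ {L = L} i∈) (∈-fromList⁻ {L = L} j∈)

  NonEdgeIn : Subset n → Set
  NonEdgeIn S = ∃ λ i → ∃ λ j → i ∈ S × j ∈ S × i ≢ j × adj G i j ≢ true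

  ¬clique⇒nonEdge : ∀ {S} → ¬ IsClique G S → NonEdgeIn S
  ¬clique⇒nonEdge {S} ¬cl with any? (λ i → any? (λ j →
    (i ∈? S) ×-dec (j ∈? S) ×-dec ¬? (i ≟ j) ×-dec ¬? (adj? i j)))
  ... | yes w = w
  ... | no ¬w = contradiction
    (λ i j i∈ j∈ i≢j → case adj? i j of λ where
      (yes a) → a
      (no ¬a) → contradiction (i , j , i∈ , j∈ , i≢j , ¬a) ¬w) ¬cl

  Straddles : Fin n → Subset n → Set
  Straddles v T = IsClique G T × v ∉ T × (∃ λ u → u ∈ T × adj G v u ≡ true) × ¬ (T ⊆ N v)

  abstract
    straddles? : ∀ v T → Dec (Straddles v T)
    straddles? v T = isClique? G T ×-dec ¬? (v ∈? T) ×-dec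
      any? (λ u → (u ∈? T) ×-dec adj? v u) ×-dec ¬? (T ⊆? N v)

  NonCliqueAt : Fin n → Subset n → Set
  NonCliqueAt v U = U ⊆ N v × ¬ IsClique G U

  abstract
    nonCliqueAt? : ∀ v U → Dec (NonCliqueAt v U)
    nonCliqueAt? v U = (U ⊆? N v) ×-dec ¬? (isClique? G U)

  -- These are p and q of the overview.
  #straddling #nonClique : Fin n → ℕ
  #straddling v = ∑ (allSubsets n) (λ T → ⟦ straddles? v T ⟧)
  #nonClique  v = ∑ (allSubsets n) (λ U → ⟦ nonCliqueAt? v U ⟧)

  CliqueAfterDeleting : Fin n → Subset n → Set
  CliqueAfterDeleting z U = z ∈ U × IsClique G (toggle z U)

  abstract
    cliqueAfterDeleting? : ∀ z U → Dec (CliqueAfterDeleting z U)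
    cliqueAfterDeleting? z U = (z ∈? U) ×-dec isClique? G (toggle z U)

  -- A clique cannot contain both ends of a non-edge, so the one vertex whose deletion leaves a
  -- clique must be one of them.
  deletes-end : ∀ {z U i j} → CliqueAfterDeleting z U → i ∈ U → j ∈ U → i ≢ j → adj G i j ≢ true → z ≡ i ⊎ z ≡ j
  deletes-end {z} {U} {i} {j} (z∈ , cl) i∈ j∈ i≢j ¬a with i ≟ z | j ≟ z
  ... | yes e | _ = inj₁ (≡-sym e)
  ... | no _  | yes e = inj₂ (≡-sym e)
  ... | no p  | no q = contradiction (cl i j (∈-toggle⁺ p i∈) (∈-toggle⁺ q j∈) i≢j) ¬a

  -- `T` is counted once for every `v` in which it meets N(z). Counting it more than once only
  -- weakens the upper bound, and this slack is one of the two sources of strictness used later.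
  StraddlesVia : Fin n → Fin n → Subset n → Set
  StraddlesVia v z T = Straddles z T × v ∈ T × adj G z v ≡ true

  abstract
    straddlesVia? : ∀ v z T → Dec (StraddlesVia v z T)
    straddlesVia? v z T = straddles? z T ×-dec (v ∈? T) ×-dec adj? z v

  Exchange : Fin n → Subset n → Fin n → Set
  Exchange v U z = NonCliqueAt v U × CliqueAfterDeleting z U

  abstract
    exchange? : ∀ v U z → Dec (Exchange v U z)
    exchange? v U z = nonCliqueAt? v U ×-dec cliqueAfterDeleting? z U

  -- Here `toggle v (toggle z U)` is T, so U = T + z - v. All of U is adjacent to `v`, because T is
  -- a clique through `v` and `z` is a neighbour of `v`; deleting `z` from U leaves the clique T -
  -- v.
  via⇒exchange : ∀ v z U → StraddlesVia v z (toggle v (toggle z U)) → Exchange v U z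
  via⇒exchange v z U ((cl , z∉T , _ , T⊈N) , v∈T , zv) = (U⊆N , U-not) , z∈U , cl′
    where
    z≢v = adj⇒≢ zv
    v∉ : v ∉ toggle z U
    v∉ = ∈-toggle-self⁻ v∈T
    v∉U : v ∉ U
    v∉U = v∉ ∘ ∈-toggle⁺ (z≢v ∘ ≡-sym)
    z∈U : z ∈ U
    z∈U with z ∈? U
    ... | yes e = e
    ... | no ne = contradiction (∈-toggle⁺ z≢v (∈-toggle-self⁺ ne)) z∉T
    ≢v : ∀ {j} → j ∈ toggle z U → j ≢ v
    ≢v e refl = v∉ e
    cl′ : IsClique G (toggle z U)
    cl′ i j i∈ j∈ = cl i j (∈-toggle⁺ (≢v i∈) i∈) (∈-toggle⁺ (≢v j∈) j∈)
    U⊆N : U ⊆ N v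
    U⊆N {j} j∈ with j ≟ z
    ... | yes refl = ∈-tabulate⁺ (adj-comm zv)
    ... | no j≢z   = ∈-tabulate⁺ (cl v j v∈T (∈-toggle⁺ (j≢v ∘ ≡-sym) (∈-toggle⁺ j≢z j∈)) j≢v)
      where
      j≢v : v ≢ j
      j≢v refl = v∉U j∈
    -- Were U a clique, `z` would be adjacent to all of T - v as well as to `v`, so T would lie
    -- inside N(z).
    U-not : ¬ IsClique G U
    U-not clU = T⊈N λ {j} j∈T → case j ≟ v of λ where
      (yes refl) → ∈-tabulate⁺ zv
      (no j≢v)   →
        let z≢j : z ≢ j
            z≢j = λ where refl → z∉T j∈T
        in ∈-tabulate⁺ (clU z j z∈U (∈-toggle⁻ (z≢j ∘ ≡-sym) (∈-toggle⁻ j≢v j∈T)) z≢j)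

  private
    V = allFin n
    P = allSubsets n

  ∑via≤∑exchange : ∑ V (λ z → ∑ P λ T → ∑ V λ v → ⟦ straddlesVia? v z T ⟧)
            ≤ ∑ V (λ v → ∑ P λ U → ∑ V λ z → ⟦ exchange? v U z ⟧)
  ∑via≤∑exchange = begin
    ∑ V (λ z → ∑ P λ T → ∑ V λ v → ⟦ straddlesVia? v z T ⟧)
      ≡⟨ ∑-cong V (λ z → ∑-swap P V λ T v → ⟦ straddlesVia? v z T ⟧) ⟩
    ∑ V (λ z → ∑ V λ v → ∑ P λ T → ⟦ straddlesVia? v z T ⟧)
      ≡⟨ ∑-swap V V (λ z v → ∑ P λ T → ⟦ straddlesVia? v z T ⟧) ⟩
    ∑ V (λ v → ∑ V λ z → ∑ P λ T → ⟦ straddlesVia? v z T ⟧)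
      -- For fixed `v` and `z`, the summation variable changes from T to U = T + z - v.
      ≡⟨ ∑-cong V (λ v → ∑-cong V λ z → trans
           (∑-toggle z (λ T → ⟦ straddlesVia? v z (toggle v T) ⟧))
           (∑-toggle v (λ T → ⟦ straddlesVia? v z T ⟧))) ⟨
    ∑ V (λ v → ∑ V λ z → ∑ P λ U → ⟦ straddlesVia? v z (toggle v (toggle z U)) ⟧)
      ≤⟨ ∑-mono V (λ v → ∑-mono V λ z → ∑-mono P λ U →
           ⟦⟧-mono (straddlesVia? v z (toggle v (toggle z U))) (exchange? v U z) (via⇒exchange v z U)) ⟩
    ∑ V (λ v → ∑ V λ z → ∑ P λ U → ⟦ exchange? v U z ⟧)
      ≡⟨ ∑-cong V (λ v → ∑-swap V P λ z U → ⟦ exchange? v U z ⟧) ⟩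
    ∑ V (λ v → ∑ P λ U → ∑ V λ z → ⟦ exchange? v U z ⟧) ∎
    where open ≤-Reasoning

  straddles≤via : ∀ z T → ⟦ straddles? z T ⟧ ≤ ∑ V λ v → ⟦ straddlesVia? v z T ⟧
  straddles≤via z T = ⟦⟧-≤ (straddles? z T) λ where
    s@(_ , _ , (u , u∈ , a) , _) → subst (_≤ _) (⟦⟧-yes (straddlesVia? u z T) (s , u∈ , a))
      (≤∑ (λ v → ⟦ straddlesVia? v z T ⟧) (∈-allFin u))

  exchange≤2 : ∀ v U → ∑ V (λ z → ⟦ exchange? v U z ⟧) ≤ 2 * ⟦ nonCliqueAt? v U ⟧
  exchange≤2 v U with nonCliqueAt? v U
  ... | no ¬q = ≤-reflexive (trans (∑-cong V λ z → ⟦⟧-no (exchange? v U z) (¬q ∘ proj₁)) (∑-zero V))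
  ... | yes q@(_ , ¬cl) with i , j , i∈ , j∈ , i≢j , ¬a ← ¬clique⇒nonEdge ¬cl = begin
    ∑ V (λ z → ⟦ exchange? v U z ⟧)
      ≤⟨ ∑-mono V (λ z → ⟦⟧-≤ (exchange? v U z) λ (_ , e) →
           case deletes-end e i∈ j∈ i≢j ¬a of λ where
             (inj₁ refl) → ≤-trans (≤-reflexive (≡-sym (⟦⟧-yes (z ≟ z) refl))) (m≤m+n _ _)
             (inj₂ refl) → ≤-trans (≤-reflexive (≡-sym (⟦⟧-yes (z ≟ z) refl))) (m≤n+m _ _)) ⟩
    ∑ V (λ z → ⟦ z ≟ i ⟧ + ⟦ z ≟ j ⟧)  ≡⟨ ∑-+ V (λ z → ⟦ z ≟ i ⟧) (λ z → ⟦ z ≟ j ⟧) ⟩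
    ∑ V (λ z → ⟦ z ≟ i ⟧) + ∑ V (λ z → ⟦ z ≟ j ⟧)  ≡⟨ cong₂ _+_ (∑-≟ i) (∑-≟ j) ⟩
    2 ∎
    where open ≤-Reasoning

  ∑2*nonClique : ∑ V (λ v → ∑ P λ U → 2 * ⟦ nonCliqueAt? v U ⟧) ≡ ∑ V (λ v → 2 * #nonClique v)
  ∑2*nonClique = ∑-cong V λ v → ∑-2* P (λ U → ⟦ nonCliqueAt? v U ⟧)
    where
    ∑-2* : ∀ {A : Set} (xs : List A) (f : A → ℕ) → ∑ xs (λ x → 2 * f x) ≡ 2 * ∑ xs f
    ∑-2* [] f = refl
    ∑-2* (x ∷ xs) f = trans (cong (2 * f x +_) (∑-2* xs f)) (≡-sym (*-distribˡ-+ 2 (f x) (∑ xs f)))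

  ∑straddling≤ : ∑ V #straddling ≤ ∑ V (λ v → 2 * #nonClique v)
  ∑straddling≤ = begin
    ∑ V #straddling                                          ≤⟨ ∑-mono V (λ z → ∑-mono P (straddles≤via z)) ⟩
    ∑ V (λ z → ∑ P λ T → ∑ V λ v → ⟦ straddlesVia? v z T ⟧)  ≤⟨ ∑via≤∑exchange ⟩
    ∑ V (λ v → ∑ P λ U → ∑ V λ z → ⟦ exchange? v U z ⟧)      ≤⟨ ∑-mono V (λ v → ∑-mono P (exchange≤2 v)) ⟩
    ∑ V (λ v → ∑ P λ U → 2 * ⟦ nonCliqueAt? v U ⟧)           ≡⟨ ∑2*nonClique ⟩
    ∑ V (λ v → 2 * #nonClique v) ∎
    where open ≤-Reasoning

  -- For the non-clique {u, x, y} inside N(v), a second non-edge leaves only one admissible `z`, the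
  -- common end of the two, where the double count allows two. `single` turns this loss into
  -- strictness of the whole inequality.
  module Thin {v u x y} (vu : adj G v u ≡ true) (vx : adj G v x ≡ true) (vy : adj G v y ≡ true)
      (u≢x : u ≢ x) (u≢y : u ≢ y) (x≢y : x ≢ y) (¬xy : adj G x y ≢ true) where
    L : List (Fin n)
    L = u ∷ x ∷ y ∷ []
    U : Subset n
    U = fromList L
    u∈ : u ∈ U
    u∈ = ∈-fromList⁺ {L = L} (here refl)
    x∈ : x ∈ U
    x∈ = ∈-fromList⁺ {L = L} (there (here refl))
    y∈ : y ∈ U
    y∈ = ∈-fromList⁺ {L = L} (there (there (here refl)))
    U⊆N : U ⊆ N v
    U⊆N e = ∈-tabulate⁺ (All.lookup {P = λ i → adj G v i ≡ true} (vu ∷ vx ∷ vy ∷ []) (∈-fromList⁻ {L = L} e))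
    single : ∀ c → (∀ z → CliqueAfterDeleting z U → z ≡ c) → ∑ V #straddling < ∑ V (λ v → 2 * #nonClique v)
    single c only = ≤-<-trans (∑-mono V (λ z → ∑-mono P (straddles≤via z))) (≤-<-trans ∑via≤∑exchange
      (<-≤-trans (∑-mono-< (λ v → ∑-mono P (exchange≤2 v)) (∈-allFin v)
         (∑-mono-< (exchange≤2 v) (∈-allSubsets U) strict)) (≤-reflexive ∑2*nonClique)))
      where
      strict : ∑ V (λ z → ⟦ exchange? v U z ⟧) < 2 * ⟦ nonCliqueAt? v U ⟧
      strict = subst (λ k → ∑ V (λ z → ⟦ exchange? v U z ⟧) < 2 * k)
        (≡-sym (⟦⟧-yes (nonCliqueAt? v U) (U⊆N , λ cl → ¬xy (cl x y x∈ y∈ x≢y))))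
        (s≤s (≤-trans (∑-mono V λ z → ⟦⟧-mono (exchange? v U z) (z ≟ c) (only z ∘ proj₂)) (≤-reflexive (∑-≟ c))))

  -- If `u` is adjacent to both `x` and `y`, the clique {v, u, x} straddles `y` and is counted
  -- through both `v` and `u`. Otherwise {u, x, y} contains a second non-edge, which shares an end
  -- with xy, and `single` applies to that end.
  ∑straddling< : ∀ {v u x y} → adj G v u ≡ true → adj G v x ≡ true → adj G v y ≡ true →
    u ≢ x → u ≢ y → x ≢ y → adj G x y ≢ true → ∑ V #straddling < ∑ V (λ v → 2 * #nonClique v)
  ∑straddling< {v} {u} {x} {y} vu vx vy u≢x u≢y x≢y ¬xy with adj? u x | adj? u y
  ... | yes ux | yes uy = <-≤-trans (∑-mono-< (λ z → ∑-mono P (straddles≤via z)) (∈-allFin y)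
        (∑-mono-< (straddles≤via y) (∈-allSubsets T) strict))
      (≤-trans ∑via≤∑exchange (≤-trans (∑-mono V (λ v → ∑-mono P (exchange≤2 v))) (≤-reflexive ∑2*nonClique)))
    where
    L : List (Fin n)
    L = v ∷ u ∷ x ∷ []
    T : Subset n
    T = fromList L
    v∈ : v ∈ T
    v∈ = ∈-fromList⁺ {L = L} (here refl)
    u∈ : u ∈ T
    u∈ = ∈-fromList⁺ {L = L} (there (here refl))
    x∈ : x ∈ T
    x∈ = ∈-fromList⁺ {L = L} (there (there (here refl)))
    y∉ : y ∉ T
    y∉ e with ∈-fromList⁻ {L = L} e
    ... | here refl                 = adj⇒≢ vy refl
    ... | there (here refl)         = u≢y refl
    ... | there (there (here refl)) = x≢y refl
    s : Straddles y T
    s = clique-fromList ((vu ∷ vx ∷ []) ∷ (ux ∷ []) ∷ [] ∷ []) , y∉ , (v , v∈ , adj-comm vy) ,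
      λ T⊆N → ¬xy (adj-comm (∈-tabulate⁻ (T⊆N x∈)))
    strict : ⟦ straddles? y T ⟧ < ∑ V λ w → ⟦ straddlesVia? w y T ⟧
    strict = ≤-trans (s≤s (⟦⟧≤1 (straddles? y T))) (begin
      2                                                ≡⟨ cong₂ _+_ (∑-≟ v) (∑-≟ u) ⟨
      ∑ V (λ z → ⟦ z ≟ v ⟧) + ∑ V (λ z → ⟦ z ≟ u ⟧)    ≡⟨ ∑-+ V (λ z → ⟦ z ≟ v ⟧) (λ z → ⟦ z ≟ u ⟧) ⟨
      ∑ V (λ z → ⟦ z ≟ v ⟧ + ⟦ z ≟ u ⟧)                ≤⟨ ∑-mono V pt ⟩
      ∑ V (λ w → ⟦ straddlesVia? w y T ⟧) ∎)
      where
      open ≤-Reasoning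
      pt : ∀ w → ⟦ w ≟ v ⟧ + ⟦ w ≟ u ⟧ ≤ ⟦ straddlesVia? w y T ⟧
      pt w with w ≟ v | w ≟ u
      ... | yes refl | yes refl = contradiction refl (adj⇒≢ vu)
      ... | yes refl | no _     = ≤-reflexive (≡-sym (⟦⟧-yes (straddlesVia? w y T) (s , v∈ , adj-comm vy)))
      ... | no _     | yes refl = ≤-reflexive (≡-sym (⟦⟧-yes (straddlesVia? w y T) (s , u∈ , adj-comm uy)))
      ... | no _     | no _     = z≤n
  ... | no ¬ux | _ = single x λ z e → case deletes-end e x∈ y∈ x≢y ¬xy of λ where
      (inj₁ z≡x) → z≡x
      (inj₂ z≡y) → case deletes-end e u∈ x∈ u≢x ¬ux of λ where
        (inj₁ z≡u) → contradiction (trans (≡-sym z≡u) z≡y) u≢y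
        (inj₂ z≡x) → z≡x
    where open Thin vu vx vy u≢x u≢y x≢y ¬xy
  ... | yes _  | no ¬uy = single y λ z e → case deletes-end e x∈ y∈ x≢y ¬xy of λ where
      (inj₂ z≡y) → z≡y
      (inj₁ z≡x) → case deletes-end e u∈ y∈ u≢y ¬uy of λ where
        (inj₁ z≡u) → contradiction (trans (≡-sym z≡u) z≡x) u≢x
        (inj₂ z≡y) → z≡y
    where open Thin vu vx vy u≢x u≢y x≢y ¬xy

-- Induced subgraphs and deletion of a closed neighbourhood

embed : (W : Subset n) → Fin ∣ W ∣ → Fin n
embed (inside  ∷ W) zero    = zero
embed (inside  ∷ W) (suc i) = suc (embed W i)
embed (outside ∷ W) i       = suc (embed W i)

embed-∈ : (W : Subset n) (i : Fin ∣ W ∣) → embed W i ∈ W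
embed-∈ (inside  ∷ W) zero    = here[]=
embed-∈ (inside  ∷ W) (suc i) = there[]= (embed-∈ W i)
embed-∈ (outside ∷ W) i       = there[]= (embed-∈ W i)

embed-injective : (W : Subset n) {i j : Fin ∣ W ∣} → embed W i ≡ embed W j → i ≡ j
embed-injective (inside  ∷ W) {zero}  {zero}  e = refl
embed-injective (inside  ∷ W) {suc i} {suc j} e = cong suc (embed-injective W (suc-injective e))
embed-injective (outside ∷ W) e = embed-injective W (suc-injective e)

embed-surjective : (W : Subset n) {j : Fin n} → j ∈ W → ∃ λ i → embed W i ≡ j
embed-surjective (inside  ∷ W) here[]= = zero , refl
embed-surjective (inside  ∷ W) (there[]= e) with i , refl ← embed-surjective W e = suc i , refl
embed-surjective (outside ∷ W) (there[]= e) with i , refl ← embed-surjective W e = i , refl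

∑-embed : (W : Subset n) (f : Fin n → ℕ) → (∀ j → j ∉ W → f j ≡ 0) →
  ∑ (allFin n) f ≡ ∑ (allFin ∣ W ∣) (f ∘ embed W)
∑-embed [] f z = refl
∑-embed (inside ∷ W) f z = trans (∑-allFin-suc f)
  (trans (cong (f zero +_) (∑-embed W (f ∘ suc) (λ j ∉W → z (suc j) λ { (there[]= e) → ∉W e })))
    (≡-sym (∑-allFin-suc (f ∘ embed (inside ∷ W)))))
∑-embed (outside ∷ W) f z = trans (∑-allFin-suc f)
  (cong₂ _+_ (z zero λ ()) (∑-embed W (f ∘ suc) (λ j ∉W → z (suc j) λ { (there[]= e) → ∉W e })))

image : (W : Subset n) → Subset ∣ W ∣ → Subset n
image []            []      = []
image (inside  ∷ W) (b ∷ S) = b ∷ image W S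
image (outside ∷ W) S       = outside ∷ image W S

image⊆ : (W : Subset n) (S : Subset ∣ W ∣) → image W S ⊆ W
image⊆ (inside  ∷ W) (b ∷ S) here[]=      = here[]=
image⊆ (inside  ∷ W) (b ∷ S) (there[]= e) = there[]= (image⊆ W S e)
image⊆ (outside ∷ W) S       (there[]= e) = there[]= (image⊆ W S e)

∈-image⁺ : (W : Subset n) {S : Subset ∣ W ∣} {i : Fin ∣ W ∣} → i ∈ S → embed W i ∈ image W S
∈-image⁺ (inside  ∷ W) {b ∷ S} here[]=      = here[]=
∈-image⁺ (inside  ∷ W) {b ∷ S} (there[]= e) = there[]= (∈-image⁺ W e)
∈-image⁺ (outside ∷ W)         e            = there[]= (∈-image⁺ W e)

∈-image⁻ : (W : Subset n) {S : Subset ∣ W ∣} {i : Fin ∣ W ∣} → embed W i ∈ image W S → i ∈ S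
∈-image⁻ (inside  ∷ W) {b ∷ S} {zero}  here[]=      = here[]=
∈-image⁻ (inside  ∷ W) {b ∷ S} {suc i} (there[]= e) = there[]= (∈-image⁻ W e)
∈-image⁻ (outside ∷ W)         (there[]= e)         = ∈-image⁻ W e

∑-image : (W : Subset n) (f : Subset n → ℕ) → (∀ S → ¬ (S ⊆ W) → f S ≡ 0) →
  ∑ (allSubsets n) f ≡ ∑ (allSubsets ∣ W ∣) (f ∘ image W)
∑-image [] f z = refl
∑-image (inside ∷ W) f z = trans (∑-allSubsets-suc f)
  (trans (cong₂ _+_ (∑-image W (f ∘ (inside ∷_)) (λ S h → z (inside ∷ S) (h ∘ drop-∷-⊆)))
                    (∑-image W (f ∘ (outside ∷_)) (λ S h → z (outside ∷ S) (h ∘ drop-∷-⊆))))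
    (≡-sym (∑-allSubsets-suc (f ∘ image (inside ∷ W)))))
∑-image {suc n} (outside ∷ W) f z = trans (∑-allSubsets-suc f)
  (cong₂ _+_ (trans (∑-cong (allSubsets n) (λ S → z (inside ∷ S) λ h → case h here[]= of λ ())) (∑-zero (allSubsets n)))
             (∑-image W (f ∘ (outside ∷_)) (λ S h → z (outside ∷ S) (h ∘ drop-∷-⊆))))

induced : Graph n → (W : Subset n) → Graph ∣ W ∣
induced G W = record
  { adj    = λ i j → adj G (embed W i) (embed W j)
  ; sym    = λ i j → sym G (embed W i) (embed W j)
  ; irrefl = λ i → irrefl G (embed W i)
  }

k≡∑ : (G : Graph n) → k G ≡ ∑ (allSubsets n) (λ S → ⟦ isClique? G S ⟧)
k≡∑ {n} G = length-filter (isClique? G) (allSubsets n)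

k-induced : (G : Graph n) (W : Subset n) →
  k (induced G W) ≡ ∑ (allSubsets n) (λ S → ⟦ isClique? G S ×-dec (S ⊆? W) ⟧)
k-induced {n} G W = trans (k≡∑ (induced G W)) (≡-sym (trans
  (∑-image W (λ S → ⟦ isClique? G S ×-dec (S ⊆? W) ⟧) (λ S h → ⟦⟧-no (isClique? G S ×-dec (S ⊆? W)) (h ∘ proj₂)))
  (∑-cong (allSubsets ∣ W ∣) λ S → ⟦⟧-cong (isClique? G (image W S) ×-dec (image W S ⊆? W)) (isClique? (induced G W) S)
    (λ (cl , _) i j i∈ j∈ i≢j → cl _ _ (∈-image⁺ W i∈) (∈-image⁺ W j∈) (i≢j ∘ embed-injective W))
    (λ cl → clique-image cl , λ {x} → image⊆ W S {x}))))
  where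
  clique-image : ∀ {S} → IsClique (induced G W) S → IsClique G (image W S)
  clique-image {S} cl i j i∈ j∈ i≢j
    with i′ , refl ← embed-surjective W (image⊆ W S i∈) | j′ , refl ← embed-surjective W (image⊆ W S j∈)
    = cl i′ j′ (∈-image⁻ W i∈) (∈-image⁻ W j∈) (i≢j ∘ cong (embed W))

degree≡∑ : (G : Graph n) (i : Fin n) → degree G i ≡ ∑ (allFin n) (λ j → ⟦ adj? G i j ⟧)
degree≡∑ {n} G i = trans (∣∣-∑ (N G i)) (∑-cong (allFin n) λ j →
  ⟦⟧-cong (j ∈? N G i) (adj? G i j) ∈-tabulate⁻ ∈-tabulate⁺)

degree-induced : (G : Graph n) (W : Subset n) (i : Fin ∣ W ∣) →
  degree (induced G W) i ≡ ∑ (allFin n) (λ j → ⟦ (j ∈? W) ×-dec adj? G (embed W i) j ⟧)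
degree-induced {n} G W i = trans (degree≡∑ (induced G W) i) (≡-sym (trans
  (∑-embed W (λ j → ⟦ (j ∈? W) ×-dec adj? G (embed W i) j ⟧)
    (λ j h → ⟦⟧-no ((j ∈? W) ×-dec adj? G (embed W i) j) (h ∘ proj₁)))
  (∑-cong (allFin ∣ W ∣) λ j → ⟦⟧-cong ((embed W j ∈? W) ×-dec adj? G (embed W i) (embed W j))
    (adj? (induced G W) i j) proj₂ (embed-∈ W j ,_))))

degree-induced≤ : (G : Graph n) (W : Subset n) (i : Fin ∣ W ∣) → degree (induced G W) i ≤ degree G (embed W i)
degree-induced≤ {n} G W i = begin
  degree (induced G W) i                                            ≡⟨ degree-induced G W i ⟩
  ∑ (allFin n) (λ j → ⟦ (j ∈? W) ×-dec adj? G (embed W i) j ⟧)      ≤⟨ ∑-mono (allFin n) (λ j →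
     ⟦⟧-mono ((j ∈? W) ×-dec adj? G (embed W i) j) (adj? G (embed W i) j) proj₂) ⟩
  ∑ (allFin n) (λ j → ⟦ adj? G (embed W i) j ⟧)                     ≡⟨ degree≡∑ G (embed W i) ⟨
  degree G (embed W i) ∎
  where open ≤-Reasoning

-- The degree inside W counts the neighbours lying in W, so a neighbour outside W would make it
-- strictly smaller than the degree in G.
full-degree⇒neighbours∈ : (G : Graph n) (W : Subset n) (i : Fin ∣ W ∣) → degree G (embed W i) ≤ degree (induced G W) i →
  ∀ j → adj G (embed W i) j ≡ true → j ∈ W
full-degree⇒neighbours∈ {n} G W i le j a with j ∈? W
... | yes e = e
... | no ne = contradiction le (<⇒≱ (begin-strict
  degree (induced G W) i                                            ≡⟨ degree-induced G W i ⟩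
  ∑ (allFin n) (λ j → ⟦ (j ∈? W) ×-dec adj? G (embed W i) j ⟧)      <⟨ ∑-mono-< (λ j →
     ⟦⟧-mono ((j ∈? W) ×-dec adj? G (embed W i) j) (adj? G (embed W i) j) proj₂) (∈-allFin j)
     (≤-reflexive (trans (cong suc (⟦⟧-no ((j ∈? W) ×-dec adj? G (embed W i) j) (ne ∘ proj₁)))
       (≡-sym (⟦⟧-yes (adj? G (embed W i) j) a)))) ⟩
  ∑ (allFin n) (λ j → ⟦ adj? G (embed W i) j ⟧)                     ≡⟨ degree≡∑ G (embed W i) ⟨
  degree G (embed W i) ∎))
  where open ≤-Reasoning

N[_]_ : Fin n → Graph n → Subset n
N[ v ] G = toggle v (N G v)

v∉N : (G : Graph n) (v : Fin n) → v ∉ N G v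
v∉N G v e = adj⇒≢ G (∈-tabulate⁻ e) refl

∈N[]-self : (G : Graph n) (v : Fin n) → v ∈ N[ v ] G
∈N[]-self G v = ∈-toggle-self⁺ (v∉N G v)

∈N[]⁺ : (G : Graph n) {v j : Fin n} → adj G v j ≡ true → j ∈ N[ v ] G
∈N[]⁺ G a = ∈-toggle⁺ (adj⇒≢ G a ∘ ≡-sym) (∈-tabulate⁺ a)

∈N[]⁻ : (G : Graph n) {v j : Fin n} → j ∈ N[ v ] G → j ≡ v ⊎ adj G v j ≡ true
∈N[]⁻ G {v} {j} e with j ≟ v
... | yes p = inj₁ p
... | no p  = inj₂ (∈-tabulate⁻ (∈-toggle⁻ p e))

∣N[]∣ : (G : Graph n) (v : Fin n) → ∣ N[ v ] G ∣ ≡ suc (degree G v)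
∣N[]∣ {n} G v = begin
  ∣ N[ v ] G ∣                                         ≡⟨ ∣∣-∑ (N[ v ] G) ⟩
  ∑ (allFin n) (λ j → ⟦ j ∈? N[ v ] G ⟧)               ≡⟨ ∑-cong (allFin n) pt ⟩
  ∑ (allFin n) (λ j → ⟦ j ≟ v ⟧ + ⟦ adj? G v j ⟧)      ≡⟨ ∑-+ (allFin n) (λ j → ⟦ j ≟ v ⟧) (λ j → ⟦ adj? G v j ⟧) ⟩
  _                                                    ≡⟨ cong₂ _+_ (∑-≟ v) (≡-sym (degree≡∑ G v)) ⟩
  suc (degree G v) ∎
  where
  open ≡-Reasoning
  pt : ∀ j → ⟦ j ∈? N[ v ] G ⟧ ≡ ⟦ j ≟ v ⟧ + ⟦ adj? G v j ⟧
  pt j with j ≟ v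
  ... | yes refl = trans (⟦⟧-yes (j ∈? N[ j ] G) (∈N[]-self G j)) (cong suc (≡-sym (⟦⟧-no (adj? G j j) λ a → adj⇒≢ G a refl)))
  ... | no j≢v   = ⟦⟧-cong (j ∈? N[ v ] G) (adj? G v j) (λ e → ∈-tabulate⁻ (∈-toggle⁻ j≢v e)) (∈N[]⁺ G)

_-N[_] : (G : Graph n) (v : Fin n) → Graph ∣ ∁ (N[ v ] G) ∣
G -N[ v ] = induced G (∁ (N[ v ] G))

double-out : ∀ a w q → a + (w + w) + 2 * q ≡ a + 2 * (w + q)
double-out = solve 3 (λ a w q → a :+ (w :+ w) :+ con 2 :* q := a :+ con 2 :* (w :+ q)) refl

module _ {n} (G : Graph n) (v : Fin n) where
  private
    P = allSubsets n
    ∁N[v] : Subset n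
    ∁N[v] = ∁ (N[ v ] G)

    Avoiding Through Within : Subset n → Set
    Avoiding S = IsClique G S × S ⊆ ∁N[v]
    Through  S = IsClique G S × v ∈ S
    Within   S = IsClique G S × S ⊆ N G v

    avoiding? : ∀ S → Dec (Avoiding S)
    avoiding? S = isClique? G S ×-dec (S ⊆? ∁N[v])

    abstract
      through? : ∀ S → Dec (Through S)
      through? S = isClique? G S ×-dec (v ∈? S)

      within? : ∀ S → Dec (Within S)
      within? S = isClique? G S ×-dec (S ⊆? N G v)

    ⊆⊥⇒∉ : ∀ {S} {j : Fin n} → S ⊆ ⊥ → j ∉ S
    ⊆⊥⇒∉ h e = ∉⊥ (h e)

    -- Every clique falls into exactly one of the four classes, except the empty one, which both
    -- avoids N[v] and lies inside N(v). The term `⟦ S ⊆? ⊥ ⟧` pays for this overlap and is the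
    -- origin of the `1` in `k-delete`.
    pointwise : ∀ S → ⟦ isClique? G S ⟧ + ⟦ S ⊆? ⊥ ⟧
      ≡ (⟦ avoiding? S ⟧ + ⟦ straddles? G v S ⟧) + (⟦ through? S ⟧ + ⟦ within? S ⟧)
    pointwise S = go (isClique? G S) (v ∈? S) (nonempty? S) (S ⊆? N G v) (any? (λ u → (u ∈? S) ×-dec adj? G v u))
      where
      values : ∀ {a b c d e f} → ⟦ isClique? G S ⟧ ≡ a → ⟦ S ⊆? ⊥ ⟧ ≡ b → ⟦ avoiding? S ⟧ ≡ c →
        ⟦ straddles? G v S ⟧ ≡ d → ⟦ through? S ⟧ ≡ e → ⟦ within? S ⟧ ≡ f → a + b ≡ (c + d) + (e + f) →
        ⟦ isClique? G S ⟧ + ⟦ S ⊆? ⊥ ⟧ ≡ (⟦ avoiding? S ⟧ + ⟦ straddles? G v S ⟧) + (⟦ through? S ⟧ + ⟦ within? S ⟧)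
      values refl refl refl refl refl refl h = h
      cl✓ = ⟦⟧-yes (isClique? G S)
      cl✗ = ⟦⟧-no (isClique? G S)
      ⊥✓ = ⟦⟧-yes (S ⊆? ⊥)
      ⊥✗ = ⟦⟧-no (S ⊆? ⊥)
      av✓ = ⟦⟧-yes (avoiding? S)
      av✗ = ⟦⟧-no (avoiding? S)
      st✓ = ⟦⟧-yes (straddles? G v S)
      st✗ = ⟦⟧-no (straddles? G v S)
      th✓ = ⟦⟧-yes (through? S)
      th✗ = ⟦⟧-no (through? S)
      wi✓ = ⟦⟧-yes (within? S)
      wi✗ = ⟦⟧-no (within? S)
      go : Dec (IsClique G S) → Dec (v ∈ S) → Dec (∃ λ j → j ∈ S) → Dec (S ⊆ N G v) →
        Dec (∃ λ u → u ∈ S × adj G v u ≡ true) → _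
      go (no ¬cl) _ _ _ _ = values (cl✗ ¬cl)
        (⊥✗ λ h → ¬cl λ i j i∈ → contradiction i∈ (⊆⊥⇒∉ h))
        (av✗ (¬cl ∘ proj₁)) (st✗ (¬cl ∘ proj₁)) (th✗ (¬cl ∘ proj₁)) (wi✗ (¬cl ∘ proj₁)) refl
      go (yes cl) (yes v∈) _ _ _ = values (cl✓ cl) (⊥✗ λ h → ⊆⊥⇒∉ h v∈)
        (av✗ λ (_ , h) → x∈∁p⇒x∉p (h v∈) (∈N[]-self G v)) (st✗ λ (_ , v∉ , _) → v∉ v∈) (th✓ (cl , v∈))
        (wi✗ λ (_ , h) → v∉N G v (h v∈)) refl
      go (yes cl) (no v∉) (no empty) _ _ = values (cl✓ cl) (⊥✓ λ {j} e → contradiction (j , e) empty)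
        (av✓ (cl , λ {j} e → contradiction (j , e) empty)) (st✗ λ (_ , _ , (u , e , _) , _) → empty (u , e))
        (th✗ (v∉ ∘ proj₂)) (wi✓ (cl , λ {j} e → contradiction (j , e) empty)) refl
      go (yes cl) (no v∉) (yes (j , j∈)) (yes ⊆N) _ = values (cl✓ cl) (⊥✗ λ h → ⊆⊥⇒∉ h j∈)
        (av✗ λ (_ , h) → x∈∁p⇒x∉p (h j∈) (∈N[]⁺ G (∈-tabulate⁻ (⊆N j∈)))) (st✗ λ (_ , _ , _ , h) → h ⊆N)
        (th✗ (v∉ ∘ proj₂)) (wi✓ (cl , ⊆N)) refl
      go (yes cl) (no v∉) (yes (j , j∈)) (no ⊈N) (yes m@(u , u∈ , a)) = values (cl✓ cl) (⊥✗ λ h → ⊆⊥⇒∉ h j∈)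
        (av✗ λ (_ , h) → x∈∁p⇒x∉p (h u∈) (∈N[]⁺ G a)) (st✓ (cl , v∉ , m , ⊈N))
        (th✗ (v∉ ∘ proj₂)) (wi✗ (⊈N ∘ proj₂)) refl
      go (yes cl) (no v∉) (yes (j , j∈)) (no ⊈N) (no ¬m) = values (cl✓ cl) (⊥✗ λ h → ⊆⊥⇒∉ h j∈)
        (av✓ (cl , λ {u} u∈ → x∉p⇒x∈∁p λ e → case ∈N[]⁻ G e of λ where
           (inj₁ refl) → v∉ u∈
           (inj₂ a)    → ¬m (u , u∈ , a)))
        (st✗ λ (_ , _ , m , _) → ¬m m)
        (th✗ (v∉ ∘ proj₂)) (wi✗ (⊈N ∘ proj₂)) refl

    -- Removing `v` from a clique through `v` leaves a clique inside N(v), and adding `v` reverses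
    -- this.
    #through≡#within : ∑ P (λ S → ⟦ through? S ⟧) ≡ ∑ P (λ S → ⟦ within? S ⟧)
    #through≡#within = trans (≡-sym (∑-toggle v (λ S → ⟦ through? S ⟧)))
      (∑-cong P λ S → ⟦⟧-cong (through? (toggle v S)) (within? S) to from)
      where
      to : ∀ {S} → Through (toggle v S) → Within S
      to {S} (cl , v∈) = (λ i j i∈ j∈ → cl i j (keep i∈) (keep j∈)) ,
        λ {j} j∈ → ∈-tabulate⁺ (cl v j v∈ (keep j∈) (≢v j∈ ∘ ≡-sym))
        where
        ≢v : ∀ {j} → j ∈ S → j ≢ v
        ≢v e refl = ∈-toggle-self⁻ v∈ e
        keep : ∀ {j} → j ∈ S → j ∈ toggle v S
        keep e = ∈-toggle⁺ (≢v e) e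
      from : ∀ {S} → Within S → Through (toggle v S)
      from {S} (cl , ⊆N) = cl′ , ∈-toggle-self⁺ (v∉N G v ∘ ⊆N)
        where
        cl′ : IsClique G (toggle v S)
        cl′ i j i∈ j∈ i≢j with i ≟ v | j ≟ v
        ... | yes refl | yes refl = contradiction refl i≢j
        ... | yes refl | no q     = ∈-tabulate⁻ (⊆N (∈-toggle⁻ q j∈))
        ... | no p     | yes refl = adj-comm G (∈-tabulate⁻ (⊆N (∈-toggle⁻ p i∈)))
        ... | no p     | no q     = cl i j (∈-toggle⁻ p i∈) (∈-toggle⁻ q j∈) i≢j

    #within+#nonClique : ∑ P (λ S → ⟦ within? S ⟧) + #nonClique G v ≡ 2 ^ degree G v
    #within+#nonClique = trans (≡-sym (∑-+ P (λ S → ⟦ within? S ⟧) (λ S → ⟦ nonCliqueAt? G v S ⟧)))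
      (trans (∑-cong P pt) (∑-⊆ (N G v)))
      where
      pt : ∀ S → ⟦ within? S ⟧ + ⟦ nonCliqueAt? G v S ⟧ ≡ ⟦ S ⊆? N G v ⟧
      pt S = go (isClique? G S)
        where
        go : Dec (IsClique G S) → _
        go (yes cl) = trans (cong₂ _+_ (⟦⟧-cong (within? S) (S ⊆? N G v) proj₂ (cl ,_))
                                       (⟦⟧-no (nonCliqueAt? G v S) λ (_ , h) → h cl)) (+-identityʳ _)
        go (no ¬cl) = cong₂ _+_ (⟦⟧-no (within? S) (¬cl ∘ proj₁))
                                (⟦⟧-cong (nonCliqueAt? G v S) (S ⊆? N G v) proj₁ (_, ¬cl))

  -- Cliques through `v` and cliques inside N(v) are equally many, say w of each, and w + q = 2^d
  -- because every subset of N(v) is a clique or not. Adding 2 q to both sides therefore turns w + w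
  -- into 2^(d+1).
  k-delete : k G + 1 + 2 * #nonClique G v ≡ k (G -N[ v ]) + #straddling G v + 2 ^ suc (degree G v)
  k-delete = begin
    k G + 1 + 2 * nc                          ≡⟨ cong (λ x → x + 2 * nc) eq ⟩
    (k (G -N[ v ]) + st) + (wi + wi) + 2 * nc    ≡⟨ double-out (k (G -N[ v ]) + st) wi nc ⟩
    (k (G -N[ v ]) + st) + 2 * (wi + nc)        ≡⟨ cong (λ x → (k (G -N[ v ]) + st) + 2 * x) #within+#nonClique ⟩
    k (G -N[ v ]) + st + 2 ^ suc (degree G v) ∎
    where
    open ≡-Reasoning
    st nc wi : ℕ
    st = #straddling G v
    nc = #nonClique G v
    wi = ∑ P (λ S → ⟦ within? S ⟧)
    eq : k G + 1 ≡ (k (G -N[ v ]) + st) + (wi + wi)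
    eq = begin
      k G + 1
        ≡⟨ cong₂ _+_ (k≡∑ G) (trans (cong (2 ^_) (≡-sym (∣⊥∣≡0 n))) (≡-sym (∑-⊆ (⊥ {n})))) ⟩
      ∑ P (λ S → ⟦ isClique? G S ⟧) + ∑ P (λ S → ⟦ S ⊆? ⊥ ⟧)
        ≡⟨ ∑-+ P (λ S → ⟦ isClique? G S ⟧) (λ S → ⟦ S ⊆? ⊥ ⟧) ⟨
      ∑ P (λ S → ⟦ isClique? G S ⟧ + ⟦ S ⊆? ⊥ ⟧)
        ≡⟨ ∑-cong P pointwise ⟩
      ∑ P (λ S → (⟦ avoiding? S ⟧ + ⟦ straddles? G v S ⟧) + (⟦ through? S ⟧ + ⟦ within? S ⟧))
        ≡⟨ ∑-+ P (λ S → ⟦ avoiding? S ⟧ + ⟦ straddles? G v S ⟧) (λ S → ⟦ through? S ⟧ + ⟦ within? S ⟧) ⟩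
      ∑ P (λ S → ⟦ avoiding? S ⟧ + ⟦ straddles? G v S ⟧) + ∑ P (λ S → ⟦ through? S ⟧ + ⟦ within? S ⟧)
        ≡⟨ cong₂ _+_ (∑-+ P (λ S → ⟦ avoiding? S ⟧) (λ S → ⟦ straddles? G v S ⟧))
                     (∑-+ P (λ S → ⟦ through? S ⟧) (λ S → ⟦ within? S ⟧)) ⟩
      _
        ≡⟨ cong₂ _+_ (cong (_+ st) (≡-sym (k-induced G ∁N[v]))) (cong (_+ wi) #through≡#within) ⟩
      (k (G -N[ v ]) + st) + (wi + wi) ∎

-- The bound

-- For positive exponents s and t the difference of the two sides is (2^s - 1)(2^t - 1), which is
-- positive; the next two lemmas add the degenerate cases, where it vanishes.
2^x+2^y< : ∀ x y → 2 ^ suc x + 2 ^ suc y < 2 ^ (suc x + suc y) + 1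
2^x+2^y< x y = begin-strict
  2 * X + 2 * Y            ≤⟨ +-mono-≤ (*-monoʳ-≤ 2 (m≤m*n X Y)) (*-monoʳ-≤ 2 (m≤n*m Y X)) ⟩
  2 * (X * Y) + 2 * (X * Y) ≡⟨ solve 2 (λ X Y → con 2 :* (X :* Y) :+ con 2 :* (X :* Y) := (con 2 :* X) :* (con 2 :* Y)) refl X Y ⟩
  2 ^ suc x * 2 ^ suc y    ≡⟨ ^-distribˡ-+-* 2 (suc x) (suc y) ⟨
  2 ^ (suc x + suc y)      <⟨ m<m+n _ (s≤s z≤n) ⟩
  2 ^ (suc x + suc y) + 1 ∎
  where
  open ≤-Reasoning
  X Y : ℕ
  X = 2 ^ x
  Y = 2 ^ y
  instance
    X≢0 : ℕ.NonZero X
    X≢0 = m^n≢0 2 x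
    Y≢0 : ℕ.NonZero Y
    Y≢0 = m^n≢0 2 y

2^x+2^y≤ : ∀ x y → 2 ^ x + 2 ^ y ≤ 2 ^ (x + y) + 1
2^x+2^y≤ zero    y       = ≤-reflexive (+-comm 1 (2 ^ y))
2^x+2^y≤ (suc x) zero    = ≤-reflexive (cong (λ z → 2 ^ z + 1) (≡-sym (+-identityʳ (suc x))))
2^x+2^y≤ (suc x) (suc y) = <⇒≤ (2^x+2^y< x y)

2^x+2^y≥⇒ : ∀ x y → 2 ^ (x + y) + 1 ≤ 2 ^ x + 2 ^ y → x ≡ 0 ⊎ y ≡ 0
2^x+2^y≥⇒ zero    y       h = inj₁ refl
2^x+2^y≥⇒ (suc x) zero    h = inj₂ refl
2^x+2^y≥⇒ (suc x) (suc y) h = contradiction h (<⇒≱ (2^x+2^y< x y))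

2^[s+x]+2^[s+y]≤ : ∀ s x y → 2 ^ (s + x) + 2 ^ (s + y) ≤ 2 ^ (s + (x + y)) + 2 ^ s
2^[s+x]+2^[s+y]≤ s x y = begin
  2 ^ (s + x) + 2 ^ (s + y)          ≡⟨ cong₂ _+_ (^-distribˡ-+-* 2 s x) (^-distribˡ-+-* 2 s y) ⟩
  2 ^ s * 2 ^ x + 2 ^ s * 2 ^ y      ≡⟨ *-distribˡ-+ (2 ^ s) (2 ^ x) (2 ^ y) ⟨
  2 ^ s * (2 ^ x + 2 ^ y)            ≤⟨ *-monoʳ-≤ (2 ^ s) (2^x+2^y≤ x y) ⟩
  2 ^ s * (2 ^ (x + y) + 1)          ≡⟨ *-distribˡ-+ (2 ^ s) (2 ^ (x + y)) 1 ⟩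
  2 ^ s * 2 ^ (x + y) + 2 ^ s * 1    ≡⟨ cong₂ _+_ (≡-sym (^-distribˡ-+-* 2 s (x + y))) (*-identityʳ _) ⟩
  2 ^ (s + (x + y)) + 2 ^ s ∎
  where open ≤-Reasoning

2^[s+x]+2^[s+y]≥⇒ : ∀ s x y → 2 ^ (s + (x + y)) + 2 ^ s ≤ 2 ^ (s + x) + 2 ^ (s + y) → x ≡ 0 ⊎ y ≡ 0
2^[s+x]+2^[s+y]≥⇒ s x y h = 2^x+2^y≥⇒ x y (*-cancelˡ-≤ (2 ^ s) {{m^n≢0 2 s}} (begin
  2 ^ s * (2 ^ (x + y) + 1)          ≡⟨ *-distribˡ-+ (2 ^ s) (2 ^ (x + y)) 1 ⟩
  2 ^ s * 2 ^ (x + y) + 2 ^ s * 1    ≡⟨ cong₂ _+_ (≡-sym (^-distribˡ-+-* 2 s (x + y))) (*-identityʳ _) ⟩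
  2 ^ (s + (x + y)) + 2 ^ s          ≤⟨ h ⟩
  2 ^ (s + x) + 2 ^ (s + y)          ≡⟨ cong₂ _+_ (^-distribˡ-+-* 2 s x) (^-distribˡ-+-* 2 s y) ⟩
  2 ^ s * 2 ^ x + 2 ^ s * 2 ^ y      ≡⟨ *-distribˡ-+ (2 ^ s) (2 ^ x) (2 ^ y) ⟨
  2 ^ s * (2 ^ x + 2 ^ y) ∎))
  where open ≤-Reasoning

-- a + k(aK_{r+1} ∪ K_b), avoiding the truncated subtraction
kmax+ : ℕ → ℕ → ℕ → ℕ
kmax+ r a b = a * 2 ^ suc r + 2 ^ b

-- Here `c` vertices have been deleted and `n` remain. With the summands `a` and `a′` cancelled
-- against those inside `kmax+`, `merge` says that K_c together with the extremal graph on the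
-- remaining vertices has at most as many cliques as the extremal graph on all of them. `tight`
-- lists when the two counts agree: K_c is then the small component or one of the copies of K_{r+1}.
record Shrunk (r a b n c : ℕ) : Set where
  field
    a′ b′   : ℕ
    size    : n ≡ a′ * suc r + b′
    b′≤r    : b′ ≤ r
    merge   : 2 ^ c + kmax+ r a′ b′ + a ≤ kmax+ r a b + 1 + a′
    tight   : kmax+ r a b + 1 + a′ ≤ 2 ^ c + kmax+ r a′ b′ + a →
              (c ≡ b × a′ ≡ a × b′ ≡ 0) ⊎ (c ≡ suc r × a ≡ suc a′ × b′ ≡ b)

shrink : ∀ {r} a b n c → 1 ≤ c → c ≤ suc r → b ≤ r → c + n ≡ a * suc r + b → Shrunk r a b n c
shrink {r} a b n c 1≤c c≤ b≤r e with c ℕ.≤? b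
-- K_c is cut out of K_b, leaving K_y with b = c + y. Equality forces y = 0, since c = 0 is
-- excluded.
... | yes c≤b with y , refl ← m≤n⇒∃[o]m+o≡n c≤b = record
  { a′ = a ; b′ = y
  ; size = +-cancelˡ-≡ c _ _ (trans e (solve 3 (λ M c y → M :+ (c :+ y) := c :+ (M :+ y)) refl (a * suc r) c y))
  ; b′≤r = ≤-trans (m≤n+m y c) b≤r
  ; merge = subst₂ _≤_ (L M (2 ^ c) (2 ^ y) a) (R M (2 ^ (c + y)) a) (+-monoˡ-≤ (M + a) (2^x+2^y≤ c y))
  ; tight = λ h → case 2^x+2^y≥⇒ c y (+-cancelʳ-≤ (M + a) _ _ (subst₂ _≤_ (≡-sym (R M (2 ^ (c + y)) a)) (≡-sym (L M (2 ^ c) (2 ^ y) a)) h)) of λ where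
      (inj₁ refl) → contradiction 1≤c λ ()
      (inj₂ refl) → inj₁ (≡-sym (+-identityʳ c) , refl , refl)
  }
  where
  M = a * 2 ^ suc r
  L : ∀ M C Y a → (C + Y) + (M + a) ≡ C + (M + Y) + a
  L = solve 4 (λ M C Y a → (C :+ Y) :+ (M :+ a) := C :+ (M :+ Y) :+ a) refl
  R : ∀ M B a → (B + 1) + (M + a) ≡ (M + B) + 1 + a
  R = solve 3 (λ M B a → (B :+ con 1) :+ (M :+ a) := (M :+ B) :+ con 1 :+ a) refl
shrink {r} zero b n c 1≤c c≤ b≤r e | no c≰b = contradiction (≤-trans (m≤m+n c n) (≤-reflexive e)) c≰b
-- K_c is larger than K_b, so one K_{r+1} is broken up. With c = b + x and r + 1 = b + x + y the
-- remainder is K_{b+y}, which has at most r vertices as x > 0; equality then forces y = 0, that is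
-- c = r + 1.
shrink {r} (suc a) b n c 1≤c c≤ b≤r e | no c≰b
  with x , refl ← m≤n⇒∃[o]m+o≡n (≰⇒≥ c≰b) | y , r≡ ← m≤n⇒∃[o]m+o≡n c≤ = record
  { a′ = a ; b′ = b + y
  ; size = +-cancelˡ-≡ c′ _ _ (trans e (trans (cong (λ z → z + a * suc r + b) (≡-sym r≡))
      (solve 4 (λ M b x y → (b :+ x) :+ y :+ M :+ b := (b :+ x) :+ (M :+ (b :+ y))) refl (a * suc r) b x y)))
  ; b′≤r = ℕ.s≤s⁻¹ (≤-trans b+y< (≤-reflexive r≡))
  ; merge = subst₂ _≤_ (L M (2 ^ c′) (2 ^ (b + y)) a) R′ (+-monoˡ-≤ (M + suc a) (2^[s+x]+2^[s+y]≤ b x y))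
  ; tight = λ h → case 2^[s+x]+2^[s+y]≥⇒ b x y (+-cancelʳ-≤ (M + suc a) _ _ (subst₂ _≤_ (≡-sym R′) (≡-sym (L M (2 ^ c′) (2 ^ (b + y)) a)) h)) of λ where
      (inj₁ refl) → contradiction (≤-reflexive (+-identityʳ b)) c≰b
      (inj₂ refl) → inj₂ (trans (≡-sym (+-identityʳ c′)) r≡ , refl , +-identityʳ b)
  }
  where
  c′ = b + x
  M = a * 2 ^ suc r
  L : ∀ M C Y a → (C + Y) + (M + suc a) ≡ C + (M + Y) + suc a
  L = solve 4 (λ M C Y a → (C :+ Y) :+ (M :+ (con 1 :+ a)) := C :+ (M :+ Y) :+ (con 1 :+ a)) refl
  R : ∀ M N B a → (N + B) + (M + suc a) ≡ (N + M + B) + 1 + a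
  R = solve 4 (λ M N B a → (N :+ B) :+ (M :+ (con 1 :+ a)) := (N :+ M :+ B) :+ con 1 :+ a) refl
  R′ : (2 ^ (b + (x + y)) + 2 ^ b) + (M + suc a) ≡ kmax+ r (suc a) b + 1 + a
  R′ = trans (cong (λ z → (2 ^ z + 2 ^ b) + (M + suc a)) (trans (≡-sym (+-assoc b x y)) r≡)) (R M (2 ^ suc r) (2 ^ b) a)
  b+y< : b + y < b + x + y
  b+y< = +-monoˡ-< y (≰⇒> c≰b)

-- Adding the three hypotheses and cancelling gives the first component; slack in any of them would be slack in it.
combine : ∀ {kG k′ p q C F F′ a a′} → kG + 1 + q ≡ k′ + p + C → p ≤ q → k′ + a′ ≤ F′ → C + F′ + a ≤ F + 1 + a′ →
  kG + a ≤ F × (F ≤ kG + a → q ≤ p × F′ ≤ k′ + a′ × F + 1 + a′ ≤ C + F′ + a)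
combine {kG} {k′} {p} {q} {C} {F} {F′} {a} {a′} e h₁ h₂ h₃ =
  +-cancelʳ-≤ Z _ _ (subst₂ _≤_ L R (+-mono-≤ h₁ (+-mono-≤ h₂ h₃))) ,
  λ F≤ → (≮⇒≥ λ l → <⇒≱ (strict (+-mono-<-≤ l (+-mono-≤ h₂ h₃))) F≤) ,
         (≮⇒≥ λ l → <⇒≱ (strict (+-mono-≤-< h₁ (+-mono-<-≤ l h₃))) F≤) ,
         (≮⇒≥ λ l → <⇒≱ (strict (+-mono-≤-< h₁ (+-mono-≤-< h₂ l))) F≤)
  where
  Z = 1 + q + a′ + F′
  L : p + (k′ + a′ + (C + F′ + a)) ≡ kG + a + Z
  L = trans (solve 6 (λ p k a′ C F′ a → p :+ (k :+ a′ :+ (C :+ F′ :+ a)) := (k :+ p :+ C) :+ (a′ :+ F′ :+ a)) refl p k′ a′ C F′ a)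
    (trans (cong (_+ (a′ + F′ + a)) (≡-sym e))
     (solve 5 (λ g q a′ F′ a → (g :+ con 1 :+ q) :+ (a′ :+ F′ :+ a) := g :+ a :+ (con 1 :+ q :+ a′ :+ F′)) refl kG q a′ F′ a))
  R : q + (F′ + (F + 1 + a′)) ≡ F + Z
  R = solve 4 (λ q F′ F a′ → q :+ (F′ :+ (F :+ con 1 :+ a′)) := F :+ (con 1 :+ q :+ a′ :+ F′)) refl q F′ F a′
  strict : p + (k′ + a′ + (C + F′ + a)) < q + (F′ + (F + 1 + a′)) → kG + a < F
  strict h = +-cancelʳ-< Z _ _ (subst₂ _<_ L R h)

maxDegree-delete : ∀ {n r} {G : Graph n} → MaxDegree≤ G r → ∀ v → MaxDegree≤ (G -N[ v ]) r
maxDegree-delete {G = G} Δ v i = ≤-trans (degree-induced≤ G (∁ (N[ v ] G)) i) (Δ _)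

size-delete : ∀ {n} (G : Graph n) v → suc (degree G v) + ∣ ∁ (N[ v ] G) ∣ ≡ n
size-delete {n} G v = trans (cong (_+ ∣ ∁ (N[ v ] G) ∣) (≡-sym (∣N[]∣ G v)))
  (trans (cong (∣ N[ v ] G ∣ +_) (∣∁p∣≡n∸∣p∣ (N[ v ] G))) (m+[n∸m]≡n (∣p∣≤n (N[ v ] G))))

shrink-at : ∀ {n r a b} (G : Graph n) → n ≡ a * suc r + b → b ≤ r → MaxDegree≤ G r → ∀ v →
  Shrunk r a b ∣ ∁ (N[ v ] G) ∣ (suc (degree G v))
shrink-at G e b≤r Δ v = shrink _ _ _ _ (s≤s z≤n) (s≤s (Δ v)) b≤r (trans (size-delete G v) e)

∃light : ∀ {n} (G : Graph (suc n)) → ∃ λ v → #straddling G v ≤ 2 * #nonClique G v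
∃light {n} G with any? (λ v → #straddling G v ℕ.≤? 2 * #nonClique G v)
... | yes w = w
... | no ¬w = contradiction (∑straddling≤ G) (<⇒≱ (∑-mono-< {xs = allFin (suc n)}
  (λ v → <⇒≤ (≰⇒> (¬w ∘ (v ,_)))) (∈-allFin zero) (≰⇒> (¬w ∘ (zero ,_)))))

Bound : ℕ → Set
Bound n = ∀ {r a b} → n ≡ a * suc r + b → b ≤ r → (G : Graph n) → MaxDegree≤ G r → k G + a ≤ kmax+ r a b

-- The bound is assumed only for the smaller graph, so that the same statement serves inside the
-- induction and, once `k-bound` is available, for reading off the equality conditions.
delete-light : ∀ {n r} {a b} (e : n ≡ a * suc r + b) (b≤r : b ≤ r) (G : Graph n) (Δ : MaxDegree≤ G r) v →
  Bound ∣ ∁ (N[ v ] G) ∣ → #straddling G v ≤ 2 * #nonClique G v →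
  let open Shrunk (shrink-at {a = a} G e b≤r Δ v) in
  k G + a ≤ kmax+ r a b × (kmax+ r a b ≤ k G + a →
    2 * #nonClique G v ≤ #straddling G v × kmax+ r a′ b′ ≤ k (G -N[ v ]) + a′ ×
    kmax+ r a b + 1 + a′ ≤ 2 ^ suc (degree G v) + kmax+ r a′ b′ + a)
delete-light {a = a} e b≤r G Δ v IH light = combine (k-delete G v) light (IH size b′≤r (G -N[ v ]) (maxDegree-delete {G = G} Δ v)) merge
  where open Shrunk (shrink-at {a = a} G e b≤r Δ v)

abstract
  k-bound : ∀ n → Bound n
  k-bound = <-rec Bound go
    where
    go : ∀ n → (∀ {m} → m < n → Bound m) → Bound n
    go zero IH {a = zero}  refl b≤r G Δ = s≤s z≤n
    go zero IH {a = suc a} ()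
    go (suc n) IH e b≤r G Δ with v , light ← ∃light G =
      proj₁ (delete-light e b≤r G Δ v (IH (delete-< G v)) light)
      where
      delete-< : ∀ {n} (G : Graph n) v → ∣ ∁ (N[ v ] G) ∣ < n
      delete-< G v = ≤-trans (s≤s (m≤n+m _ (degree G v))) (≤-reflexive (size-delete G v))

-- Deleting a closed neighbourhood from a graph that attains the bound

record Extremal (r a b : ℕ) {n} (G : Graph n) : Set where
  constructor extremal
  field
    size  : n ≡ a * suc r + b
    b≤r   : b ≤ r
    Δ≤r   : MaxDegree≤ G r
    max   : kmax+ r a b ≤ k G + a

module _ {n r a b} {G : Graph n} (ext : Extremal r a b G) where
  open Extremal ext

  -- At a vertex with p ≤ 2 q the deletion inequality is an equality, which includes p = 2 q; at any
  -- other vertex p > 2 q already.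
  all-heavy : ∀ v → 2 * #nonClique G v ≤ #straddling G v
  all-heavy v with #straddling G v ℕ.≤? 2 * #nonClique G v
  ... | yes l = proj₁ (proj₂ (delete-light size b≤r G Δ≤r v (k-bound _) l) max)
  ... | no ¬l = ≰⇒≥ ¬l

  -- Since p ≥ 2 q everywhere while the sum of p is at most that of 2 q, strict inequality is
  -- impossible anywhere. Hence the deletion argument is available at every vertex, not just at one
  -- found by averaging.
  all-light : ∀ v → #straddling G v ≤ 2 * #nonClique G v
  all-light v = ≮⇒≥ λ l → <⇒≱ (∑-mono-< all-heavy (∈-allFin v) l) (∑straddling≤ G)

  -- The third neighbour `u` is essential: it is what makes the double count strict when `x` and `y`
  -- are not adjacent. C₄ and C₅ escape because their vertices have only two neighbours.
  neighbours-adjacent : ∀ {v u x y} → adj G v u ≡ true → adj G v x ≡ true → adj G v y ≡ true →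
    u ≢ x → u ≢ y → x ≢ y → adj G x y ≡ true
  neighbours-adjacent {x = x} {y} vu vx vy u≢x u≢y x≢y with adj? G x y
  ... | yes a = a
  ... | no ¬a = contradiction (∑-mono (allFin n) all-heavy) (<⇒≱ (∑straddling< G vu vx vy u≢x u≢y x≢y ¬a))

  -- N[v] has the size either of the small component K_b or of one copy of K_{r+1}, and what remains
  -- is again extremal.
  DeletionCases : Fin n → Set
  DeletionCases v = (suc (degree G v) ≡ b × Extremal r a 0 (G -N[ v ]))
    ⊎ (degree G v ≡ r × ∃ λ a′ → a ≡ suc a′ × Extremal r a′ b (G -N[ v ]))

  abstract
    extremal-delete : ∀ v → DeletionCases v
    extremal-delete v = conclude (tight (proj₂ (proj₂ equalities)))
      where
      open Shrunk (shrink-at {a = a} G size b≤r Δ≤r v) renaming (size to size′)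
      equalities : 2 * #nonClique G v ≤ #straddling G v × kmax+ r a′ b′ ≤ k (G -N[ v ]) + a′ ×
        kmax+ r a b + 1 + a′ ≤ 2 ^ suc (degree G v) + kmax+ r a′ b′ + a
      equalities = proj₂ (delete-light size b≤r G Δ≤r v (k-bound _) (all-light v)) max
      ext′ : Extremal r a′ b′ (G -N[ v ])
      ext′ = extremal size′ b′≤r (maxDegree-delete {G = G} Δ≤r v) (proj₁ (proj₂ equalities))
      conclude : (suc (degree G v) ≡ b × a′ ≡ a × b′ ≡ 0) ⊎ (suc (degree G v) ≡ suc r × a ≡ suc a′ × b′ ≡ b) →
        DeletionCases v
      conclude (inj₁ (c≡b , a′≡a , b′≡0)) = inj₁ (c≡b , subst₂ (λ a b → Extremal r a b (G -N[ v ])) a′≡a b′≡0 ext′)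
      conclude (inj₂ (c≡ , a≡ , b′≡b)) =
        inj₂ (ℕ-suc-injective c≡ , a′ , a≡ , subst (λ b → Extremal r a′ b (G -N[ v ])) b′≡b ext′)

-- Embeddings, isomorphisms and disjoint unions

record Embeds (H : Graph m) (G : Graph n) (f : Fin m → Fin n) : Set where
  constructor embeds
  field
    inj  : ∀ {i j} → f i ≡ f j → i ≡ j
    pres : ∀ i j → adj G (f i) (f j) ≡ adj H i j
open Embeds

record Apart (G : Graph n) (f : Fin p → Fin n) (g : Fin q → Fin n) : Set where
  constructor apart
  field
    disjoint : ∀ i j → f i ≢ g j
    no-edge  : ∀ i j → adj G (f i) (g j) ≡ false
open Apart

-- If `y` were missed, punching it out would give an injection into a smaller set.
injective⇒surjective : {f : Fin n → Fin n} → (∀ {i j} → f i ≡ f j → i ≡ j) → ∀ y → ∃ λ x → f x ≡ y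
injective⇒surjective {suc n} {f} inj y with any? (λ x → f x ≟ y)
... | yes w = w
... | no ¬w = contradiction (injective⇒≤ {f = λ x → punchOut (y≢ x)} (λ e → inj (punchOut-injective (y≢ _) (y≢ _) e))) (<⇒≱ (n<1+n n))
  where
  y≢ : ∀ x → y ≢ f x
  y≢ x e = ¬w (x , ≡-sym e)

Embeds⇒≅ : {H : Graph m} {G : Graph n} {f : Fin m → Fin n} → m ≡ n → Embeds H G f → H ≅ G
Embeds⇒≅ refl e = mk⤖ (inj e , λ y → let x , fx≡y = injective⇒surjective (inj e) y in x , λ { refl → fx≡y }) , pres e

≅⇒Embeds : {H : Graph m} {G : Graph n} (h : H ≅ G) → Embeds H G (Bijection.to (proj₁ h))
≅⇒Embeds (f , h) = embeds (Bijection.injective f) h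

module _ {H : Graph m} {G : Graph n} (h : H ≅ G) where
  private module F = Bijection (proj₁ h)

  ≅-from : Fin n → Fin m
  ≅-from y = proj₁ (F.strictlySurjective y)

  ≅-to-from : ∀ y → F.to (≅-from y) ≡ y
  ≅-to-from y = proj₂ (F.strictlySurjective y)

  ≅-from-to : ∀ x → ≅-from (F.to x) ≡ x
  ≅-from-to x = F.injective (≅-to-from (F.to x))

  ≅-from-embeds : Embeds G H ≅-from
  ≅-from-embeds = embeds (λ e → trans (≡-sym (≅-to-from _)) (trans (cong F.to e) (≅-to-from _)))
    λ i j → trans (≡-sym (proj₂ h _ _)) (cong₂ (adj G) (≅-to-from i) (≅-to-from j))

  ≅⇒size : m ≡ n
  ≅⇒size = ≤-antisym (injective⇒≤ F.injective) (injective⇒≤ (inj ≅-from-embeds))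

≅-sym : {H : Graph m} {G : Graph n} → H ≅ G → G ≅ H
≅-sym {H = H} {G} h = Embeds⇒≅ (≡-sym (≅⇒size {H = H} {G} h)) (≅-from-embeds {H = H} {G} h)

Embeds-∘ : {A : Graph m} {B : Graph n} {C : Graph p} {g : Fin n → Fin p} {f : Fin m → Fin n} →
  Embeds B C g → Embeds A B f → Embeds A C (g ∘ f)
Embeds-∘ eg ef = embeds (inj ef ∘ inj eg) λ i j → trans (pres eg _ _) (pres ef i j)

≅-trans : {A : Graph m} {B : Graph n} {C : Graph p} → A ≅ B → B ≅ C → A ≅ C
≅-trans {A = A} {B} {C} f g = Embeds⇒≅ (trans (≅⇒size {H = A} {B} f) (≅⇒size {H = B} {C} g))
  (Embeds-∘ (≅⇒Embeds {H = B} {C} g) (≅⇒Embeds {H = A} {B} f))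

Apart-∘ : {B : Graph m} {C : Graph n} {e : Fin m → Fin n} {f : Fin p → Fin m} {g : Fin q → Fin m} →
  Embeds B C e → Apart B f g → Apart C (e ∘ f) (e ∘ g)
Apart-∘ e a = apart (λ i j → disjoint a i j ∘ inj e) λ i j → trans (pres e _ _) (no-edge a i j)

module _ {A : Graph m} {B : Graph n} where

  adj-∪ˡ : ∀ i j → adj (A ∪G B) (i ↑ˡ n) (j ↑ˡ n) ≡ adj A i j
  adj-∪ˡ i j rewrite splitAt-↑ˡ m i n | splitAt-↑ˡ m j n = refl

  adj-∪ʳ : ∀ i j → adj (A ∪G B) (m ↑ʳ i) (m ↑ʳ j) ≡ adj B i j
  adj-∪ʳ i j rewrite splitAt-↑ʳ m n i | splitAt-↑ʳ m n j = refl

  adj-∪ˡʳ : ∀ i j → adj (A ∪G B) (i ↑ˡ n) (m ↑ʳ j) ≡ false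
  adj-∪ˡʳ i j rewrite splitAt-↑ˡ m i n | splitAt-↑ʳ m n j = refl

  ↑ˡ-embeds : Embeds A (A ∪G B) (_↑ˡ n)
  ↑ˡ-embeds = embeds (↑ˡ-injective n _ _) adj-∪ˡ

  ↑ʳ-embeds : Embeds B (A ∪G B) (m ↑ʳ_)
  ↑ʳ-embeds = embeds (↑ʳ-injective m _ _) adj-∪ʳ

  ↑ˡ≢↑ʳ : ∀ (i : Fin m) (j : Fin n) → i ↑ˡ n ≢ m ↑ʳ j
  ↑ˡ≢↑ʳ i j e = case trans (≡-sym (splitAt-↑ˡ m i n)) (trans (cong (splitAt m) e) (splitAt-↑ʳ m n j)) of λ ()

  ↑-apart : Apart (A ∪G B) (_↑ˡ n) (m ↑ʳ_)
  ↑-apart = apart ↑ˡ≢↑ʳ adj-∪ˡʳ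

data Split (m n : ℕ) : Fin (m + n) → Set where
  left  : ∀ i → Split m n (i ↑ˡ n)
  right : ∀ j → Split m n (m ↑ʳ j)

split : ∀ m n (i : Fin (m + n)) → Split m n i
split m n i with splitAt m i in eq
... | inj₁ j = subst (Split m n) (splitAt⁻¹-↑ˡ eq) (left j)
... | inj₂ j = subst (Split m n) (splitAt⁻¹-↑ʳ eq) (right j)

infixr 5 _▽_
_▽_ : (Fin m → Fin p) → (Fin n → Fin p) → Fin (m + n) → Fin p
_▽_ {m} f g i = [ f , g ]′ (splitAt m i)

module _ {m n p} (f : Fin m → Fin p) (g : Fin n → Fin p) where
  ▽ˡ : ∀ i → (f ▽ g) (i ↑ˡ n) ≡ f i
  ▽ˡ i = cong [ f , g ]′ (splitAt-↑ˡ m i n)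
  ▽ʳ : ∀ j → (f ▽ g) (m ↑ʳ j) ≡ g j
  ▽ʳ j = cong [ f , g ]′ (splitAt-↑ʳ m n j)

▽-embeds : {A : Graph m} {B : Graph n} {G : Graph p} {f : Fin m → Fin p} {g : Fin n → Fin p} →
  Embeds A G f → Embeds B G g → Apart G f g → Embeds (A ∪G B) G (f ▽ g)
▽-embeds {m} {n} {A = A} {B} {G} {f} {g} ef eg ap = embeds injective preserves
  where
  injective : ∀ {i j} → (f ▽ g) i ≡ (f ▽ g) j → i ≡ j
  injective {i} {j} e with split m n i | split m n j
  ... | left x  | left y  = cong (_↑ˡ n) (inj ef (trans (≡-sym (▽ˡ f g x)) (trans e (▽ˡ f g y))))
  ... | left x  | right y = contradiction (trans (≡-sym (▽ˡ f g x)) (trans e (▽ʳ f g y))) (disjoint ap x y)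
  ... | right x | left y  = contradiction (trans (≡-sym (▽ˡ f g y)) (trans (≡-sym e) (▽ʳ f g x))) (disjoint ap y x)
  ... | right x | right y = cong (m ↑ʳ_) (inj eg (trans (≡-sym (▽ʳ f g x)) (trans e (▽ʳ f g y))))
  preserves : ∀ i j → adj G ((f ▽ g) i) ((f ▽ g) j) ≡ adj (A ∪G B) i j
  preserves i j with split m n i | split m n j
  ... | left x  | left y  = trans (cong₂ (adj G) (▽ˡ f g x) (▽ˡ f g y)) (trans (pres ef x y) (≡-sym (adj-∪ˡ {A = A} {B} x y)))
  ... | left x  | right y = trans (cong₂ (adj G) (▽ˡ f g x) (▽ʳ f g y)) (trans (no-edge ap x y) (≡-sym (adj-∪ˡʳ {A = A} {B} x y)))
  ... | right x | left y  = trans (cong₂ (adj G) (▽ʳ f g x) (▽ˡ f g y)) (trans (sym G (g x) (f y)) (trans (no-edge ap y x)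
                              (≡-sym (trans (sym (A ∪G B) (m ↑ʳ x) (y ↑ˡ n)) (adj-∪ˡʳ {A = A} {B} y x)))))
  ... | right x | right y = trans (cong₂ (adj G) (▽ʳ f g x) (▽ʳ f g y)) (trans (pres eg x y) (≡-sym (adj-∪ʳ {A = A} {B} x y)))

▽-apart : ∀ {k} {G : Graph k} {f : Fin m → Fin k} {g : Fin n → Fin k} {h : Fin p → Fin k} →
  Apart G f h → Apart G g h → Apart G (f ▽ g) h
▽-apart {m} {n} {G = G} {f} {g} {h} af ag = apart dis ne
  where
  dis : ∀ i j → (f ▽ g) i ≢ h j
  dis i j e with split m n i
  ... | left x  = disjoint af x j (trans (≡-sym (▽ˡ f g x)) e)
  ... | right x = disjoint ag x j (trans (≡-sym (▽ʳ f g x)) e)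
  ne : ∀ i j → adj G ((f ▽ g) i) (h j) ≡ false
  ne i j with split m n i
  ... | left x  = trans (cong (λ z → adj G z (h j)) (▽ˡ f g x)) (no-edge af x j)
  ... | right x = trans (cong (λ z → adj G z (h j)) (▽ʳ f g x)) (no-edge ag x j)

-- This lets a component K_{r+1} that was split off be counted as the first of the `copies`.
∪-assoc : (A : Graph m) (B : Graph n) (C : Graph p) → ((A ∪G B) ∪G C) ≅ (A ∪G (B ∪G C))
∪-assoc {m} {n} {p} A B C = Embeds⇒≅ (+-assoc m n p)
  (▽-embeds (▽-embeds ↑ˡ-embeds (Embeds-∘ inBC ↑ˡ-embeds) a₁)
            (Embeds-∘ inBC ↑ʳ-embeds)
            (▽-apart a₂ (Apart-∘ inBC ↑-apart)))
  where
  inBC : Embeds (B ∪G C) (A ∪G (B ∪G C)) (m ↑ʳ_)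
  inBC = ↑ʳ-embeds {A = A} {B ∪G C}
  a₁ : Apart (A ∪G (B ∪G C)) (_↑ˡ (n + p)) ((m ↑ʳ_) ∘ (_↑ˡ p))
  a₁ = apart (λ i j → disjoint (↑-apart {A = A} {B ∪G C}) i (j ↑ˡ p)) λ i j → no-edge (↑-apart {A = A} {B ∪G C}) i (j ↑ˡ p)
  a₂ : Apart (A ∪G (B ∪G C)) (_↑ˡ (n + p)) ((m ↑ʳ_) ∘ (n ↑ʳ_))
  a₂ = apart (λ i j → disjoint (↑-apart {A = A} {B ∪G C}) i (n ↑ʳ j)) λ i j → no-edge (↑-apart {A = A} {B ∪G C}) i (n ↑ʳ j)

-- Clique numbers of isomorphic graphs, complete graphs and disjoint unions

_≟ˢ_ : (S T : Subset n) → Dec (S ≡ T)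
_≟ˢ_ = ≡-dec Bool._≟_

∑-≟ˢ : (T : Subset n) → ∑ (allSubsets n) (λ S → ⟦ S ≟ˢ T ⟧) ≡ 1
∑-≟ˢ [] = refl
∑-≟ˢ {suc n} (b ∷ T) = trans (∑-allSubsets-suc {n} (λ S → ⟦ S ≟ˢ (b ∷ T) ⟧)) (halves b)
  where
  same : ∀ b → ∑ (allSubsets n) (λ S → ⟦ (b ∷ S) ≟ˢ (b ∷ T) ⟧) ≡ 1
  same b = trans (∑-cong (allSubsets n) λ S → ⟦⟧-cong ((b ∷ S) ≟ˢ (b ∷ T)) (S ≟ˢ T) ∷-injectiveʳ (cong (b ∷_))) (∑-≟ˢ T)
  other : ∀ {b c} → b ≢ c → ∑ (allSubsets n) (λ S → ⟦ (b ∷ S) ≟ˢ (c ∷ T) ⟧) ≡ 0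
  other {b} {c} ne = trans (∑-cong (allSubsets n) λ S → ⟦⟧-no ((b ∷ S) ≟ˢ (c ∷ T)) (ne ∘ ∷-injectiveˡ)) (∑-zero (allSubsets n))
  halves : ∀ b → ∑ (allSubsets n) (λ S → ⟦ (inside ∷ S) ≟ˢ (b ∷ T) ⟧) + ∑ (allSubsets n) (λ S → ⟦ (outside ∷ S) ≟ˢ (b ∷ T) ⟧) ≡ 1
  halves true  = cong₂ _+_ (same true) (other {false} {true} λ ())
  halves false = cong₂ _+_ (other {true} {false} λ ()) (same false)

-- Pairs (S, T) with T a clique of G and S its preimage are counted in two ways: each clique S of H
-- lies in such a pair, with its image, and each T determines its S.
k-≅-≤ : {H : Graph m} {G : Graph n} → H ≅ G → k H ≤ k G
k-≅-≤ {m} {n} {H} {G} h = begin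
  k H                                                        ≡⟨ k≡∑ H ⟩
  ∑ Pm (λ S → ⟦ isClique? H S ⟧)                             ≤⟨ ∑-mono Pm (λ S → ⟦⟧-≤ (isClique? H S) λ cl →
     ≤-trans (≤-reflexive (≡-sym (⟦⟧-yes (pair? S (push S)) (pushed cl , pull-push S))))
             (≤∑ (λ T → ⟦ pair? S T ⟧) (∈-allSubsets (push S)))) ⟩
  ∑ Pm (λ S → ∑ Pn λ T → ⟦ pair? S T ⟧)                      ≡⟨ ∑-swap Pm Pn (λ S T → ⟦ pair? S T ⟧) ⟩
  ∑ Pn (λ T → ∑ Pm λ S → ⟦ pair? S T ⟧)                      ≤⟨ ∑-mono Pn inner ⟩
  ∑ Pn (λ T → ⟦ isClique? G T ⟧)                             ≡⟨ k≡∑ G ⟨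
  k G ∎
  where
  open ≤-Reasoning
  Pm = allSubsets m
  Pn = allSubsets n
  module F = Bijection (proj₁ h)
  from = ≅-from {H = H} {G} h
  push : Subset m → Subset n
  push S = tabulate (lookup S ∘ from)
  pull : Subset n → Subset m
  pull T = tabulate (lookup T ∘ F.to)
  pull-push : ∀ S → S ≡ pull (push S)
  pull-push S = ≡-sym (trans (tabulate-cong (λ i → trans (lookup∘tabulate (lookup S ∘ from) (F.to i))
    (cong (lookup S) (≅-from-to {H = H} {G} h i)))) (tabulate∘lookup S))
  pair? : ∀ S T → Dec (IsClique G T × S ≡ pull T)
  pair? S T = isClique? G T ×-dec (S ≟ˢ pull T)
  pushed : ∀ {S} → IsClique H S → IsClique G (push S)
  pushed {S} cl i j i∈ j∈ i≢j = trans (≡-sym (pres e i j)) (cl (from i) (from j) (back i∈) (back j∈) (i≢j ∘ inj e))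
    where
    e = ≅-from-embeds {H = H} {G} h
    back : ∀ {i} → i ∈ push S → from i ∈ S
    back {i} i∈ = lookup⇒[]= (from i) S (∈-tabulate⁻ i∈)
  inner : ∀ T → ∑ Pm (λ S → ⟦ pair? S T ⟧) ≤ ⟦ isClique? G T ⟧
  inner T = go (isClique? G T)
    where
    go : Dec (IsClique G T) → _
    go (yes cl) = ≤-trans (∑-mono Pm λ S → ⟦⟧-mono (pair? S T) (S ≟ˢ pull T) proj₂)
      (≤-reflexive (trans (∑-≟ˢ (pull T)) (≡-sym (⟦⟧-yes (isClique? G T) cl))))
    go (no ¬cl) = ≤-trans (≤-reflexive (trans (∑-cong Pm λ S → ⟦⟧-no (pair? S T) (¬cl ∘ proj₁)) (∑-zero Pm))) z≤n

k-≅ : {H : Graph m} {G : Graph n} → H ≅ G → k H ≡ k G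
k-≅ {H = H} {G} h = ≤-antisym (k-≅-≤ {H = H} {G} h) (k-≅-≤ {H = G} {H} (≅-sym {H = H} {G} h))

adj-K : {i j : Fin n} → i ≢ j → adj (K n) i j ≡ true
adj-K {i = i} {j} ne with i ≟ j
... | yes e = contradiction e ne
... | no _  = refl

k-K : ∀ n → k (K n) ≡ 2 ^ n
k-K n = trans (k≡∑ (K n)) (trans (∑-cong (allSubsets n) λ S →
  ⟦⟧-cong (isClique? (K n) S) (S ⊆? ⊤) (λ _ _ → ∈⊤) (λ _ i j _ _ → adj-K))
  (trans (∑-⊆ (⊤ {n})) (cong (2 ^_) (∣⊤∣≡n n))))

∑-allSubsets-+ : ∀ m {n} (f : Subset (m + n) → ℕ) →
  ∑ (allSubsets (m + n)) f ≡ ∑ (allSubsets m) (λ S → ∑ (allSubsets n) λ T → f (S Vec.++ T))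
∑-allSubsets-+ zero    f = ≡-sym (+-identityʳ _)
∑-allSubsets-+ (suc m) {n} f = trans (∑-allSubsets-suc f) (trans
  (cong₂ _+_ (∑-allSubsets-+ m (f ∘ (inside ∷_))) (∑-allSubsets-+ m (f ∘ (outside ∷_))))
  (≡-sym (∑-allSubsets-suc {m} (λ S → ∑ (allSubsets n) λ T → f (S Vec.++ T)))))

∑-⊥ : {Q : Set} (q : Dec Q) (d : (S : Subset n) → Dec (S ⊆ ⊥ × Q)) → ∑ (allSubsets n) (λ S → ⟦ d S ⟧) ≡ ⟦ q ⟧
∑-⊥ {n} (yes a) d = trans (∑-cong (allSubsets n) λ S → ⟦⟧-cong (d S) (S ⊆? ⊥) proj₁ λ h → (λ {x} → h {x}) , a)
  (trans (∑-⊆ (⊥ {n})) (cong (2 ^_) (∣⊥∣≡0 n)))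
∑-⊥ {n} (no ¬a) d = trans (∑-cong (allSubsets n) λ S → ⟦⟧-no (d S) (¬a ∘ proj₂)) (∑-zero (allSubsets n))

module _ {m n} (A : Graph m) (B : Graph n) where
  private
    Pm = allSubsets m
    Pn = allSubsets n

    ∈ˡ⁺ : ∀ {S : Subset m} {T : Subset n} {i} → i ∈ S → i ↑ˡ n ∈ S Vec.++ T
    ∈ˡ⁺ {S} {T} {i} e = lookup⇒[]= _ _ (trans (lookup-++ˡ S T i) ([]=⇒lookup e))
    ∈ˡ⁻ : ∀ {S : Subset m} {T : Subset n} {i} → i ↑ˡ n ∈ S Vec.++ T → i ∈ S
    ∈ˡ⁻ {S} {T} {i} e = lookup⇒[]= _ _ (trans (≡-sym (lookup-++ˡ S T i)) ([]=⇒lookup e))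
    ∈ʳ⁺ : ∀ {S : Subset m} {T : Subset n} {i} → i ∈ T → m ↑ʳ i ∈ S Vec.++ T
    ∈ʳ⁺ {S} {T} {i} e = lookup⇒[]= _ _ (trans (lookup-++ʳ S T i) ([]=⇒lookup e))
    ∈ʳ⁻ : ∀ {S : Subset m} {T : Subset n} {i} → m ↑ʳ i ∈ S Vec.++ T → i ∈ T
    ∈ʳ⁻ {S} {T} {i} e = lookup⇒[]= _ _ (trans (≡-sym (lookup-++ʳ S T i)) ([]=⇒lookup e))

    abstract
      both? : ∀ (S : Subset m) (T : Subset n) → Dec (S ⊆ ⊥ × T ⊆ ⊥)
      both? S T = (S ⊆? ⊥) ×-dec (T ⊆? ⊥)
      inB? : ∀ (S : Subset m) (T : Subset n) → Dec (S ⊆ ⊥ × IsClique B T)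
      inB? S T = (S ⊆? ⊥) ×-dec isClique? B T
      inA? : ∀ (S : Subset m) (T : Subset n) → Dec (T ⊆ ⊥ × IsClique A S)
      inA? S T = (T ⊆? ⊥) ×-dec isClique? A S

    ⊆⊥? : ∀ {n} (S : Subset n) → S ⊆ ⊥ ⊎ ∃ λ i → i ∈ S
    ⊆⊥? S with nonempty? S
    ... | yes w = inj₂ w
    ... | no ¬w = inj₁ λ {x} e → contradiction (x , e) ¬w

    cl-B : ∀ {S T} → S ⊆ ⊥ → IsClique B T → IsClique (A ∪G B) (S Vec.++ T)
    cl-B {S} {T} h cl i j i∈ j∈ i≢j with split m n i | split m n j
    ... | left x  | _       = contradiction (h (∈ˡ⁻ i∈)) ∉⊥
    ... | right x | left y  = contradiction (h (∈ˡ⁻ j∈)) ∉⊥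
    ... | right x | right y = trans (adj-∪ʳ {A = A} {B} x y) (cl x y (∈ʳ⁻ {S} i∈) (∈ʳ⁻ {S} j∈) (i≢j ∘ cong (m ↑ʳ_)))

    cl-A : ∀ {S T} → T ⊆ ⊥ → IsClique A S → IsClique (A ∪G B) (S Vec.++ T)
    cl-A {S} {T} h cl i j i∈ j∈ i≢j with split m n i | split m n j
    ... | right x | _       = contradiction (h (∈ʳ⁻ {S} i∈)) ∉⊥
    ... | left x  | right y = contradiction (h (∈ʳ⁻ {S} j∈)) ∉⊥
    ... | left x  | left y  = trans (adj-∪ˡ {A = A} {B} x y) (cl x y (∈ˡ⁻ i∈) (∈ˡ⁻ j∈) (i≢j ∘ cong (_↑ˡ n)))

    cl-B⁻ : ∀ {S T} → IsClique (A ∪G B) (S Vec.++ T) → IsClique B T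
    cl-B⁻ {S} cl x y x∈ y∈ x≢y = trans (≡-sym (adj-∪ʳ {A = A} {B} x y))
      (cl _ _ (∈ʳ⁺ {S} x∈) (∈ʳ⁺ {S} y∈) (x≢y ∘ ↑ʳ-injective m _ _))

    cl-A⁻ : ∀ {S T} → IsClique (A ∪G B) (S Vec.++ T) → IsClique A S
    cl-A⁻ {S} {T} cl x y x∈ y∈ x≢y = trans (≡-sym (adj-∪ˡ {A = A} {B} x y))
      (cl _ _ (∈ˡ⁺ x∈) (∈ˡ⁺ y∈) (x≢y ∘ ↑ˡ-injective n _ _))

    -- No edge joins the two sides, so a clique of the union lives on one of them; the empty clique
    -- lives on both, and `both?` accounts for it.
    pointwise : ∀ S T → ⟦ isClique? (A ∪G B) (S Vec.++ T) ⟧ + ⟦ both? S T ⟧ ≡ ⟦ inA? S T ⟧ + ⟦ inB? S T ⟧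
    pointwise S T with ⊆⊥? S | ⊆⊥? T
    ... | inj₁ s | inj₁ t = cong₂ _+_
      (⟦⟧-cong (isClique? (A ∪G B) (S Vec.++ T)) (inA? S T) (λ cl → (λ {x} → t {x}) , cl-A⁻ cl) (λ (_ , cl) → cl-A t cl))
      (⟦⟧-cong (both? S T) (inB? S T) (λ _ → (λ {x} → s {x}) , λ i j i∈ → contradiction (t i∈) ∉⊥)
         (λ _ → (λ {x} → s {x}) , λ {x} → t {x}))
    ... | inj₁ s | inj₂ (_ , t) = trans (cong₂ _+_
      (⟦⟧-cong (isClique? (A ∪G B) (S Vec.++ T)) (inB? S T) (λ cl → (λ {x} → s {x}) , cl-B⁻ {S} cl) (λ (h , cl) → cl-B h cl))
      (⟦⟧-no (both? S T) λ (_ , h) → ∉⊥ (h t)))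
      (trans (+-identityʳ _) (cong (_+ ⟦ inB? S T ⟧) (≡-sym (⟦⟧-no (inA? S T) λ (h , _) → ∉⊥ (h t)))))
    ... | inj₂ (_ , s) | inj₁ t = cong₂ _+_
      (⟦⟧-cong (isClique? (A ∪G B) (S Vec.++ T)) (inA? S T) (λ cl → (λ {x} → t {x}) , cl-A⁻ cl) (λ (h , cl) → cl-A h cl))
      (trans (⟦⟧-no (both? S T) λ (h , _) → ∉⊥ (h s)) (≡-sym (⟦⟧-no (inB? S T) λ (h , _) → ∉⊥ (h s))))
    ... | inj₂ (x , s) | inj₂ (y , t) = trans (cong₂ _+_
      (⟦⟧-no (isClique? (A ∪G B) (S Vec.++ T)) λ cl → case trans (≡-sym (adj-∪ˡʳ {A = A} {B} x y))
        (cl _ _ (∈ˡ⁺ s) (∈ʳ⁺ {S} t) (↑ˡ≢↑ʳ {A = A} {B} x y)) of λ ())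
      (⟦⟧-no (both? S T) λ (h , _) → ∉⊥ (h s)))
      (≡-sym (cong₂ _+_ (⟦⟧-no (inA? S T) λ (h , _) → ∉⊥ (h t)) (⟦⟧-no (inB? S T) λ (h , _) → ∉⊥ (h s))))

  k-∪ : k (A ∪G B) + 1 ≡ k A + k B
  k-∪ = begin
    k (A ∪G B) + 1
      ≡⟨ cong₂ _+_ (trans (k≡∑ (A ∪G B)) (∑-allSubsets-+ m _)) (≡-sym one) ⟩
    ∑ Pm (λ S → ∑ Pn λ T → ⟦ isClique? (A ∪G B) (S Vec.++ T) ⟧) + ∑ Pm (λ S → ∑ Pn λ T → ⟦ both? S T ⟧)
      ≡⟨ merge₂ (λ S T → ⟦ isClique? (A ∪G B) (S Vec.++ T) ⟧) (λ S T → ⟦ both? S T ⟧) ⟨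
    ∑ Pm (λ S → ∑ Pn λ T → ⟦ isClique? (A ∪G B) (S Vec.++ T) ⟧ + ⟦ both? S T ⟧)
      ≡⟨ ∑-cong Pm (λ S → ∑-cong Pn (pointwise S)) ⟩
    ∑ Pm (λ S → ∑ Pn λ T → ⟦ inA? S T ⟧ + ⟦ inB? S T ⟧)
      ≡⟨ merge₂ (λ S T → ⟦ inA? S T ⟧) (λ S T → ⟦ inB? S T ⟧) ⟩
    ∑ Pm (λ S → ∑ Pn λ T → ⟦ inA? S T ⟧) + ∑ Pm (λ S → ∑ Pn λ T → ⟦ inB? S T ⟧)
      ≡⟨ cong₂ _+_
          (trans (∑-cong Pm λ S → ∑-⊥ (isClique? A S) (inA? S)) (≡-sym (k≡∑ A)))
          (trans (∑-swap Pm Pn λ S T → ⟦ inB? S T ⟧)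
            (trans (∑-cong Pn λ T → ∑-⊥ (isClique? B T) (λ S → inB? S T)) (≡-sym (k≡∑ B)))) ⟩
    k A + k B ∎
    where
    open ≡-Reasoning
    merge₂ : (f g : Subset m → Subset n → ℕ) → ∑ Pm (λ S → ∑ Pn λ T → f S T + g S T) ≡ ∑ Pm (λ S → ∑ Pn (f S)) + ∑ Pm (λ S → ∑ Pn (g S))
    merge₂ f g = trans (∑-cong Pm λ S → ∑-+ Pn (f S) (g S)) (∑-+ Pm (λ S → ∑ Pn (f S)) (λ S → ∑ Pn (g S)))
    one : ∑ Pm (λ S → ∑ Pn λ T → ⟦ both? S T ⟧) ≡ 1
    one = trans (∑-swap Pm Pn λ S T → ⟦ both? S T ⟧)
      (trans (∑-cong Pn λ T → ∑-⊥ (T ⊆? ⊥) (λ S → both? S T)) (trans (∑-⊆ (⊥ {n})) (cong (2 ^_) (∣⊥∣≡0 n))))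

k-copies : ∀ a (A : Graph m) → k (copies a A) + a ≡ a * k A + 1
k-copies zero    A = refl
k-copies (suc a) A = begin
  k (A ∪G copies a A) + suc a        ≡⟨ solve 2 (λ x a → x :+ (con 1 :+ a) := x :+ con 1 :+ a) refl (k (A ∪G copies a A)) a ⟩
  k (A ∪G copies a A) + 1 + a        ≡⟨ cong (_+ a) (k-∪ A (copies a A)) ⟩
  k A + k (copies a A) + a           ≡⟨ +-assoc (k A) _ a ⟩
  k A + (k (copies a A) + a)         ≡⟨ cong (k A +_) (k-copies a A) ⟩
  k A + (a * k A + 1)                ≡⟨ +-assoc (k A) _ 1 ⟨
  suc a * k A + 1 ∎
  where
  open ≡-Reasoning

k-copies-∪ : ∀ a (A : Graph m) (B : Graph n) → k (copies a A ∪G B) + a ≡ a * k A + k B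
k-copies-∪ a A B = +-cancelʳ-≡ 1 _ _ (begin
  k (copies a A ∪G B) + a + 1        ≡⟨ solve 2 (λ x a → x :+ a :+ con 1 := x :+ con 1 :+ a) refl (k (copies a A ∪G B)) a ⟩
  k (copies a A ∪G B) + 1 + a        ≡⟨ cong (_+ a) (k-∪ (copies a A) B) ⟩
  k (copies a A) + k B + a           ≡⟨ solve 3 (λ x y a → x :+ y :+ a := x :+ a :+ y) refl (k (copies a A)) (k B) a ⟩
  k (copies a A) + a + k B           ≡⟨ cong (_+ k B) (k-copies a A) ⟩
  a * k A + 1 + k B                  ≡⟨ solve 2 (λ x y → x :+ con 1 :+ y := x :+ y :+ con 1) refl (a * k A) (k B) ⟩
  a * k A + k B + 1 ∎)
  where
  open ≡-Reasoning

k-extremal : ∀ r a b → k (copies a (K (suc r)) ∪G K b) + a ≡ kmax+ r a b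
k-extremal r a b = trans (k-copies-∪ a (K (suc r)) (K b)) (cong₂ (λ x y → a * x + y) (k-K (suc r)) (k-K b))

k-C₄ : k (C 4) ≡ 9
k-C₄ = refl

k-C₅ : k (C 5) ≡ 11
k-C₅ = refl

-- Extremal graphs

-- The sum is the multiplicity of `j` in `L`. Summed over all `j` it gives the length, so comparing
-- multiplicities pointwise yields the pigeonhole statements below.
∑-occurrences≤1 : {L : List (Fin n)} → Unique L → ∀ j → ∑ L (λ i → ⟦ j ≟ i ⟧) ≤ 1
∑-occurrences≤1 []      j = z≤n
∑-occurrences≤1 {L = i ∷ L} (h ∷ u) j with j ≟ i
... | no _     = ∑-occurrences≤1 u j
... | yes refl = s≤s (≤-reflexive (absent h))
  where
  absent : ∀ {L} → All (i ≢_) L → ∑ L (λ i′ → ⟦ i ≟ i′ ⟧) ≡ 0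
  absent []       = refl
  absent {x ∷ _} (ne ∷ h) = cong₂ _+_ (⟦⟧-no (i ≟ x) ne) (absent h)

∑∑-≟ : (L : List (Fin n)) → ∑ (allFin n) (λ j → ∑ L λ i → ⟦ j ≟ i ⟧) ≡ length L
∑∑-≟ {n} L = trans (∑-swap (allFin n) L (λ j i → ⟦ j ≟ i ⟧)) (ones L)
  where
  ones : ∀ L → ∑ L (λ i → ∑ (allFin n) λ j → ⟦ j ≟ i ⟧) ≡ length L
  ones []      = refl
  ones (i ∷ L) = cong₂ _+_ (∑-≟ i) (ones L)

occurs⇒∈ : {L : List (Fin n)} {j : Fin n} → 1 ≤ ∑ L (λ i → ⟦ j ≟ i ⟧) → j Mem.∈ L
occurs⇒∈ {L = i ∷ L} {j} h with j ≟ i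
... | yes refl = here refl
... | no _     = there (occurs⇒∈ h)

∈⇒occurs : {L : List (Fin n)} {j : Fin n} → j Mem.∈ L → 1 ≤ ∑ L (λ i → ⟦ j ≟ i ⟧)
∈⇒occurs {j = j} e = ≤-trans (≤-reflexive (≡-sym (⟦⟧-yes (j ≟ j) refl))) (≤∑ (λ i → ⟦ j ≟ i ⟧) e)

module _ (G : Graph n) where

  length≤degree : ∀ {v L} → Unique L → All (λ u → adj G v u ≡ true) L → length L ≤ degree G v
  length≤degree {v} {L} u h = subst₂ _≤_ (∑∑-≟ L) (≡-sym (degree≡∑ G v)) (∑-mono (allFin n) pt)
    where
    pt : ∀ j → ∑ L (λ i → ⟦ j ≟ i ⟧) ≤ ⟦ adj? G v j ⟧
    pt j with adj? G v j
    ... | yes _ = ∑-occurrences≤1 u j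
    ... | no ¬a = ≮⇒≥ λ 0< → ¬a (All.lookup h (occurs⇒∈ 0<))

  abstract
    another-neighbour : ∀ {v} L → length L < degree G v → ∃ λ u → adj G v u ≡ true × u Mem.∉ L
    another-neighbour {v} L l with any? (λ u → adj? G v u ×-dec ¬? (DecMem._∈?_ _≟_ u L))
    ... | yes w = w
    ... | no ¬w = contradiction
      (subst₂ _≤_ (≡-sym (degree≡∑ G v)) (∑∑-≟ L) (∑-mono (allFin n) λ j → ⟦⟧-≤ (adj? G v j) λ a → ∈⇒occurs (member j a)))
      (<⇒≱ l)
      where
      member : ∀ j → adj G v j ≡ true → j Mem.∈ L
      member j a with DecMem._∈?_ _≟_ j L
      ... | yes e = e
      ... | no ne = contradiction (j , a , ne) ¬w

  only-neighbours : ∀ {v} L → Unique L → All (λ u → adj G v u ≡ true) L → degree G v ≤ length L →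
    ∀ {u} → adj G v u ≡ true → u Mem.∈ L
  only-neighbours {v} L uL h l {u} a with DecMem._∈?_ _≟_ u L
  ... | yes e = e
  ... | no ne = contradiction l (<⇒≱ (length≤degree (All.tabulate (λ e eq → ne (subst (Mem._∈ L) (≡-sym eq) e)) ∷ uL) (a ∷ h)))

another-vertex : (L : List (Fin n)) → length L < n → ∃ λ u → u Mem.∉ L
another-vertex {n} L l with any? (λ u → ¬? (DecMem._∈?_ _≟_ u L))
... | yes w = w
... | no ¬w = contradiction
  (subst₂ _≤_ (∑-one n) (∑∑-≟ L) (∑-mono (allFin n) {λ _ → 1} λ j → ∈⇒occurs (member j)))
  (<⇒≱ l)
  where
  member : ∀ j → j Mem.∈ L
  member j with DecMem._∈?_ _≟_ j L
  ... | yes e = e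
  ... | no ne = contradiction (j , ne) ¬w

Unique⇒length≤ : {L : List (Fin n)} → Unique L → length L ≤ n
Unique⇒length≤ {n} {L} u = ≮⇒≥ λ n<l → <⇒≱ n<l (subst₂ _≤_ (∑∑-≟ L) (∑-one n) (∑-mono (allFin n) (∑-occurrences≤1 u)))

Unique⇒complete : {L : List (Fin n)} → Unique L → length L ≡ n → ∀ u → u Mem.∈ L
Unique⇒complete {L = L} uL l≡n u with DecMem._∈?_ _≟_ u L
... | yes e = e
... | no ne = contradiction (Unique⇒length≤ (All.tabulate (λ e eq → ne (subst (Mem._∈ L) (≡-sym eq) e)) ∷ uL)) (<⇒≱ (s≤s (≤-reflexive (≡-sym l≡n))))

-- By symmetry and irreflexivity only pairs i < j need checking: six of them for C₄ and ten for C₅.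
pairs⇒Embeds : {H : Graph m} {G : Graph n} {f : Fin m → Fin n} →
  AllPairs (λ i j → f i ≢ f j × adj G (f i) (f j) ≡ adj H i j) (allFin m) → Embeds H G f
pairs⇒Embeds {H = H} {G} {f} h = embeds injective preserves
  where
  R : ∀ {i j} → i ≢ j → f i ≢ f j × adj G (f i) (f j) ≡ adj H i j
  R {i} {j} = allPairs⇒ (λ (ne , e) → ne ∘ ≡-sym , trans (sym G _ _) (trans e (sym H _ _))) h (∈-allFin i) (∈-allFin j)
  injective : ∀ {i j} → f i ≡ f j → i ≡ j
  injective {i} {j} e with i ≟ j
  ... | yes p = p
  ... | no p  = contradiction e (proj₁ (R p))
  preserves : ∀ i j → adj G (f i) (f j) ≡ adj H i j
  preserves i j with i ≟ j
  ... | yes refl = trans (irrefl G (f i)) (≡-sym (irrefl H i))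
  ... | no p     = proj₂ (R p)

-- Extremal graphs with and without a splitting vertex

CliqueNbhd : Graph n → Fin n → Set
CliqueNbhd G v = ∀ x y → adj G v x ≡ true → adj G v y ≡ true → x ≢ y → adj G x y ≡ true

-- When the maximum degree is at most r, such a vertex is one whose closed neighbourhood is a
-- component K_{r+1}.
Full : ℕ → Graph n → Set
Full r G = ∃ λ v → degree G v ≡ r × CliqueNbhd G v

abstract
  full? : ∀ r (G : Graph n) → Dec (Full r G)
  full? r G = any? λ v → (degree G v ℕ.≟ r) ×-dec all? λ x → all? λ y →
    adj? G v x →-dec (adj? G v y →-dec (¬? (x ≟ y) →-dec adj? G x y))

-- The vertex has degree r already inside W, so the degree bound leaves it no neighbour outside W
-- and its neighbourhood is the same in G.
full-induced : ∀ {r} {G : Graph n} → MaxDegree≤ G r → (W : Subset n) → Full r (induced G W) → Full r G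
full-induced {r = r} {G} Δ W (i , refl , cl) =
  embed W i , ≤-antisym (Δ (embed W i)) (degree-induced≤ G W i) , cl′
  where
  cl′ : CliqueNbhd G (embed W i)
  cl′ x y ax ay x≢y
    with x′ , refl ← embed-surjective W (full-degree⇒neighbours∈ G W i (Δ (embed W i)) x ax)
       | y′ , refl ← embed-surjective W (full-degree⇒neighbours∈ G W i (Δ (embed W i)) y ay)
    = cl x′ y′ ax ay (x≢y ∘ cong (embed W))

Regular : ℕ → Graph n → Set
Regular r G = ∀ v → degree G v ≡ r

Exceptional : Graph n → Set
Exceptional G = G ≅ C 4 ⊎ G ≅ C 5

-- w and z are the second neighbours of x and y; the path w x v y z closes up to C₄ if w = z and to C₅ otherwise.
module TwoRegular {n} (G : Graph n) (reg : Regular 2 G) {v x y : Fin n}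
  (vx : adj G v x ≡ true) (vy : adj G v y ≡ true) (x≢y : x ≢ y) (¬xy : adj G x y ≢ true) where

  private
    infix 4 _~_
    _~_ : Fin n → Fin n → Set
    i ~ j = adj G i j ≡ true

    two : ∀ {v x y} → v ~ x → v ~ y → x ≢ y → ∀ {u} → v ~ u → u ≡ x ⊎ u ≡ y
    two {v} {x} {y} vx vy x≢y vu
      with only-neighbours G (x ∷ y ∷ []) ((x≢y ∷ []) ∷ [] ∷ []) (vx ∷ vy ∷ []) (≤-reflexive (reg v)) vu
    ... | here e         = inj₁ e
    ... | there (here e) = inj₂ e

    abstract
      other : ∀ {v} x → ∃ λ u → v ~ u × u ≢ x
      other {v} x with u , a , ne ← another-neighbour G (x ∷ []) (≤-reflexive (≡-sym (reg v))) = u , a , ne ∘ here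

    w  = proj₁ (other {x} v)
    xw : x ~ w
    xw = proj₁ (proj₂ (other {x} v))
    w≢v : w ≢ v
    w≢v = proj₂ (proj₂ (other {x} v))
    z  = proj₁ (other {y} v)
    yz : y ~ z
    yz = proj₁ (proj₂ (other {y} v))
    z≢v : z ≢ v
    z≢v = proj₂ (proj₂ (other {y} v))
    v≢x = adj⇒≢ G vx
    v≢y = adj⇒≢ G vy
    x≢w = adj⇒≢ G xw
    y≢z = adj⇒≢ G yz
    y≢w : y ≢ w
    y≢w e = ¬xy (subst (x ~_) (≡-sym e) xw)
    x≢z : x ≢ z
    x≢z e = ¬xy (adj-comm G (subst (y ~_) (≡-sym e) yz))
    ¬vw : adj G v w ≢ true
    ¬vw a with two vx vy x≢y a
    ... | inj₁ e = x≢w (≡-sym e)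
    ... | inj₂ e = y≢w (≡-sym e)
    ¬vz : adj G v z ≢ true
    ¬vz a with two vx vy x≢y a
    ... | inj₁ e = x≢z (≡-sym e)
    ... | inj₂ e = y≢z (≡-sym e)

    vxyw : Unique (v ∷ x ∷ y ∷ w ∷ [])
    vxyw = (v≢x ∷ v≢y ∷ w≢v ∘ ≡-sym ∷ []) ∷ (x≢y ∷ x≢w ∷ []) ∷ (y≢w ∷ []) ∷ [] ∷ []

  size≢3 : n ≢ 3
  size≢3 refl = contradiction (Unique⇒length≤ vxyw) λ { (s≤s (s≤s (s≤s ()))) }

  size4⇒C₄ : n ≡ 4 → G ≅ C 4
  size4⇒C₄ refl = ≅-sym {H = C 4} {G} (Embeds⇒≅ refl (pairs⇒Embeds {H = C 4} {G} {f}
    ( ((v≢x , vx) ∷ (w≢v ∘ ≡-sym , Bool.¬-not ¬vw) ∷ (v≢y , vy) ∷ [])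
    ∷ ((x≢w , xw) ∷ (x≢y , Bool.¬-not ¬xy) ∷ [])
    ∷ ((y≢w ∘ ≡-sym , wy) ∷ [])
    ∷ [] ∷ [])))
    where
    f : Fin 4 → Fin 4
    f = lookup (v ∷ x ∷ w ∷ y ∷ [])
    z≡w : z ≡ w
    z≡w with Unique⇒complete vxyw refl z
    ... | here e                         = contradiction e z≢v
    ... | there (here e)                 = contradiction (≡-sym e) x≢z
    ... | there (there (here e))         = contradiction (≡-sym e) y≢z
    ... | there (there (there (here e))) = e
    wy : w ~ y
    wy = adj-comm G (subst (y ~_) z≡w yz)

  size5⇒C₅ : n ≡ 5 → G ≅ C 5
  size5⇒C₅ refl = ≅-sym {H = C 5} {G} (Embeds⇒≅ refl (pairs⇒Embeds {H = C 5} {G} {f}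
    ( ((v≢x , vx) ∷ (w≢v ∘ ≡-sym , Bool.¬-not ¬vw) ∷ (z≢v ∘ ≡-sym , Bool.¬-not ¬vz) ∷ (v≢y , vy) ∷ [])
    ∷ ((x≢w , xw) ∷ (x≢z , Bool.¬-not ¬xz) ∷ (x≢y , Bool.¬-not ¬xy) ∷ [])
    ∷ ((w≢z , wz) ∷ (y≢w ∘ ≡-sym , Bool.¬-not ¬wy) ∷ [])
    ∷ ((y≢z ∘ ≡-sym , adj-comm G yz) ∷ [])
    ∷ [] ∷ [])))
    where
    f : Fin 5 → Fin 5
    f = lookup (v ∷ x ∷ w ∷ z ∷ y ∷ [])
    -- otherwise v, x, w, y is a 4-cycle and the fifth vertex has no possible neighbour
    w≢z : w ≢ z
    w≢z w≡z with u , u∉ ← another-vertex (v ∷ x ∷ y ∷ w ∷ []) (n<1+n 4)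
            with t , ut , _ ← other {u} u
            with Unique⇒complete (All.tabulate (λ e eq → u∉ (subst (Mem._∈ _) (≡-sym eq) e)) ∷ vxyw) refl t
    ... | here refl                              = adj⇒≢ G ut refl
    ... | there (here refl) = case two vx vy x≢y (adj-comm G ut) of λ where
      (inj₁ refl) → u∉ (there (here refl))
      (inj₂ refl) → u∉ (there (there (here refl)))
    ... | there (there (here refl)) = case two (adj-comm G vx) xw (w≢v ∘ ≡-sym) (adj-comm G ut) of λ where
      (inj₁ refl) → u∉ (here refl)
      (inj₂ refl) → u∉ (there (there (there (here refl))))
    ... | there (there (there (here refl))) = case two (adj-comm G vy) yz (z≢v ∘ ≡-sym) (adj-comm G ut) of λ where
      (inj₁ refl) → u∉ (here refl)
      (inj₂ refl) → u∉ (there (there (there (here (≡-sym w≡z)))))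
    ... | there (there (there (there (here refl)))) =
      case two (adj-comm G xw) (adj-comm G (subst (y ~_) (≡-sym w≡z) yz)) x≢y (adj-comm G ut) of λ where
      (inj₁ refl) → u∉ (there (here refl))
      (inj₂ refl) → u∉ (there (there (here refl)))
    ¬xz : adj G x z ≢ true
    ¬xz a with two (adj-comm G vx) xw (w≢v ∘ ≡-sym) a
    ... | inj₁ e = z≢v e
    ... | inj₂ e = w≢z (≡-sym e)
    ¬wy : adj G w y ≢ true
    ¬wy a with two (adj-comm G vy) yz (z≢v ∘ ≡-sym) (adj-comm G a)
    ... | inj₁ e = w≢v e
    ... | inj₂ e = w≢z e
    wz : w ~ z
    -- Of the five vertices, only `z` is left to be the second neighbour of `w`.
    wz with t , wt , t≢x ← other {w} x
       with Unique⇒complete {L = z ∷ v ∷ x ∷ y ∷ w ∷ []}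
              ((z≢v ∷ x≢z ∘ ≡-sym ∷ y≢z ∘ ≡-sym ∷ w≢z ∘ ≡-sym ∷ []) ∷ vxyw) refl t
    ... | here refl                                 = wt
    ... | there (here refl)                         = contradiction (adj-comm G wt) ¬vw
    ... | there (there (here refl))                 = contradiction refl t≢x
    ... | there (there (there (here refl)))         = contradiction wt ¬wy
    ... | there (there (there (there (here refl)))) = contradiction refl (adj⇒≢ G wt)

  -- x has a second neighbour outside N[v], and 2-regularity of G - N[v] leaves it no edge back to x
  delete-not-regular : ¬ Regular 2 (G -N[ v ])
  delete-not-regular reg′ = x∈∁p⇒x∉p x∈ (∈N[]⁺ G vx)
    where
    W : Subset n
    W = ∁ (N[ v ] G)
    w∈ : w ∈ W
    w∈ = x∉p⇒x∈∁p λ e → case ∈N[]⁻ G e of λ where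
      (inj₁ e) → w≢v e
      (inj₂ a) → ¬vw a
    x∈ : x ∈ W
    x∈ with i , e ← embed-surjective W w∈ =
      full-degree⇒neighbours∈ G W i (≤-reflexive (trans (reg _) (≡-sym (reg′ i)))) x
        (subst (_~ x) (≡-sym e) (adj-comm G xw))

-- Regularity is part of the exceptional alternative for the sake of the induction: G - N[v] cannot
-- be 2-regular when `v` has non-adjacent neighbours in a 2-regular G, and this rules out an
-- exceptional G - N[v].
Structure : ℕ → Set
Structure n = ∀ {r a b} {G : Graph n} → Extremal r (suc a) b G →
  Full r G ⊎ (r ≡ 2 × a ≡ 0 × Regular r G × Exceptional G)

Exceptional⇒size : {G : Graph n} → Exceptional G → n ≡ 4 ⊎ n ≡ 5
Exceptional⇒size {G = G} (inj₁ h) = inj₁ (≅⇒size {H = G} {C 4} h)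
Exceptional⇒size {G = G} (inj₂ h) = inj₂ (≅⇒size {H = G} {C 5} h)

delete-< : (G : Graph n) → ∀ v → ∣ ∁ (N[ v ] G) ∣ < n
delete-< G v = ≤-trans (s≤s (m≤n+m _ (degree G v))) (≤-reflexive (size-delete G v))

module NotFull {n r a b} {G : Graph n} (IH : ∀ {m} → m < n → Structure m)
  (ext : Extremal r (suc a) b G) (¬full : ¬ Full r G) where
  open Extremal ext

  not-full-delete : ∀ v → ¬ Full r (G -N[ v ])
  not-full-delete v = ¬full ∘ full-induced {G = G} Δ≤r (∁ (N[ v ] G))

  regular : Regular r G
  regular v with extremal-delete ext v
  ... | inj₂ (d≡r , _) = d≡r
  -- Here G - N[v] is extremal with b = 0. Being exceptional would force r = 2 and a single K₃,
  -- hence 3 vertices, whereas C₄ and C₅ have 4 and 5.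
  ... | inj₁ (_ , ext′) with IH (delete-< G v) ext′
  ... | inj₁ full = contradiction full (not-full-delete v)
  ... | inj₂ (refl , refl , _ , exc) with Exceptional⇒size {G = G -N[ v ]} exc | Extremal.size ext′
  ... | inj₁ e | e′ = case trans (≡-sym e) e′ of λ ()
  ... | inj₂ e | e′ = case trans (≡-sym e) e′ of λ ()

  vertex : Fin n
  vertex = subst Fin (≡-sym size) zero

  abstract
    nonadjacent-neighbours : ∀ v → ∃ λ x → ∃ λ y → adj G v x ≡ true × adj G v y ≡ true × x ≢ y × adj G x y ≢ true
    nonadjacent-neighbours v with any? (λ x → any? λ y → adj? G v x ×-dec adj? G v y ×-dec ¬? (x ≟ y) ×-dec ¬? (adj? G x y))
    ... | yes w = w
    ... | no ¬w = contradiction (v , regular v , λ x y vx vy x≢y → case adj? G x y of λ where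
            (yes a) → a
            (no ¬a) → contradiction (x , y , vx , vy , x≢y , ¬a) ¬w) ¬full

  degree≥2 : 2 ≤ r
  degree≥2 with x , y , vx , vy , x≢y , _ ← nonadjacent-neighbours vertex =
    ≤-trans (length≤degree G {L = x ∷ y ∷ []} ((x≢y ∷ []) ∷ [] ∷ []) (vx ∷ vy ∷ [])) (Δ≤r vertex)

  -- If r ≥ 3, regularity supplies a third neighbour, and then any two neighbours of the vertex are
  -- adjacent.
  degree≤2 : r ≤ 2
  degree≤2 with x , y , vx , vy , x≢y , ¬xy ← nonadjacent-neighbours vertex = ≮⇒≥ λ 3≤r →
    let u , vu , u∉ = another-neighbour G (x ∷ y ∷ []) (≤-trans 3≤r (≤-reflexive (≡-sym (regular vertex))))
    in ¬xy (neighbours-adjacent ext vu vx vy (u∉ ∘ here) (u∉ ∘ there ∘ here) x≢y)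

  exceptional : r ≡ 2 → a ≡ 0 × Exceptional G
  exceptional refl with x , y , vx , vy , x≢y , ¬xy ← nonadjacent-neighbours vertex
                   with extremal-delete ext vertex
  -- Here b would be 3, while b ≤ r = 2.
  ... | inj₁ (d+1≡b , _) = contradiction
          (≤-trans (≤-reflexive (trans (cong suc (≡-sym (regular vertex))) d+1≡b)) b≤r) λ { (s≤s (s≤s ())) }
  -- Now n = 3 + b with b ≤ 2, so only 3, 4 and 5 vertices are possible.
  ... | inj₂ (_ , zero , refl , _) = refl , small b b≤r size
    where
    open TwoRegular G regular vx vy x≢y ¬xy
    small : ∀ b → b ≤ 2 → n ≡ 3 + b → Exceptional G
    small 0 _ e = contradiction e size≢3
    small 1 _ e = inj₁ (size4⇒C₄ e)
    small 2 _ e = inj₂ (size5⇒C₅ e)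
    small (suc (suc (suc _))) (s≤s (s≤s ())) _
  ... | inj₂ (_ , suc _ , refl , ext′) with IH (delete-< G vertex) ext′
  ... | inj₁ full = contradiction full (not-full-delete vertex)
  ... | inj₂ (_ , _ , reg′ , _) = contradiction reg′ (TwoRegular.delete-not-regular G regular vx vy x≢y ¬xy)

structure : ∀ n → Structure n
structure = <-rec Structure λ n IH {r} {a} {b} {G} ext → case full? r G of λ where
  (yes full) → inj₁ full
  (no ¬full) → let open NotFull IH ext ¬full
                   r≡2 = ≤-antisym degree≤2 degree≥2
                   a≡0 , exc = exceptional r≡2
               in inj₂ (r≡2 , a≡0 , regular , exc)

-- Splitting off a component K_{r+1}

cast-injective : .(e : m ≡ n) {i j : Fin m} → cast e i ≡ cast e j → i ≡ j
cast-injective e {i} {j} h = toℕ-injective (trans (≡-sym (toℕ-cast e i)) (trans (cong toℕ h) (toℕ-cast e j)))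

complete⇒Embeds : {G : Graph n} {f : Fin m → Fin n} → (∀ {i j} → f i ≡ f j → i ≡ j) →
  (∀ i j → i ≢ j → adj G (f i) (f j) ≡ true) → Embeds (K m) G f
complete⇒Embeds {m = m} {G} {f} inj h = embeds inj preserves
  where
  preserves : ∀ i j → adj G (f i) (f j) ≡ adj (K m) i j
  preserves i j with i ≟ j
  ... | yes refl = irrefl G (f i)
  ... | no ne    = h i j ne

embed-Embeds : (G : Graph n) (W : Subset n) → Embeds (induced G W) G (embed W)
embed-Embeds G W = embeds (embed-injective W) λ i j → refl

module _ {n r a b} {G : Graph n} (ext : Extremal r (suc a) b G) {v} (d≡r : degree G v ≡ r) (clN : CliqueNbhd G v) where
  private
    open Extremal ext
    W : Subset n
    W = N[ v ] G

    ∣W∣ : suc r ≡ ∣ W ∣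
    ∣W∣ = ≡-sym (trans (∣N[]∣ G v) (cong suc d≡r))

    W-clique : IsClique G W
    W-clique x y x∈ y∈ x≢y with ∈N[]⁻ G x∈ | ∈N[]⁻ G y∈
    ... | inj₁ refl | inj₁ refl = contradiction refl x≢y
    ... | inj₁ refl | inj₂ vy   = vy
    ... | inj₂ vx   | inj₁ refl = adj-comm G vx
    ... | inj₂ vx   | inj₂ vy   = clN x y vx vy x≢y

    -- The set W is a clique of r + 1 vertices, so each of them has r neighbours inside W. As the
    -- degrees in G are at most r, no edge leaves W.
    r≤degree : ∀ i → r ≤ degree (induced G W) i
    r≤degree i = ℕ.s≤s⁻¹ (begin
      suc r                                     ≡⟨ trans ∣W∣ (∣∣-∑ W) ⟩
      ∑ (allFin n) (λ j → ⟦ j ∈? W ⟧)           ≤⟨ ∑-mono (allFin n) (λ j → ⟦⟧-≤ (j ∈? W) (pt j)) ⟩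
      ∑ (allFin n) (λ j → ⟦ j ≟ w ⟧ + ⟦ (j ∈? W) ×-dec adj? G w j ⟧)
        ≡⟨ ∑-+ (allFin n) (λ j → ⟦ j ≟ w ⟧) (λ j → ⟦ (j ∈? W) ×-dec adj? G w j ⟧) ⟩
      _                                         ≡⟨ cong₂ _+_ (∑-≟ w) (≡-sym (degree-induced G W i)) ⟩
      suc (degree (induced G W) i) ∎)
      where
      open ≤-Reasoning
      w : Fin n
      w = embed W i
      pt : ∀ j → j ∈ W → 1 ≤ ⟦ j ≟ w ⟧ + ⟦ (j ∈? W) ×-dec adj? G w j ⟧
      pt j j∈ with j ≟ w
      ... | yes _  = s≤s z≤n
      ... | no j≢w = ≤-reflexive (≡-sym (⟦⟧-yes ((j ∈? W) ×-dec adj? G w j)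
                       (j∈ , W-clique w j (embed-∈ W i) j∈ (j≢w ∘ ≡-sym))))

    f : Fin (suc r) → Fin n
    f = embed W ∘ cast ∣W∣

    component : Embeds (K (suc r)) G f
    component = complete⇒Embeds {G = G} (cast-injective ∣W∣ ∘ embed-injective W)
      λ i j i≢j → W-clique _ _ (embed-∈ W _) (embed-∈ W _) (i≢j ∘ cast-injective ∣W∣ ∘ embed-injective W)

    W-apart : Apart G f (embed (∁ W))
    W-apart = apart
      (λ i j e → x∈∁p⇒x∉p (embed-∈ (∁ W) j) (subst (_∈ W) e (embed-∈ W _)))
      (λ i j → Bool.¬-not λ a → x∈∁p⇒x∉p (embed-∈ (∁ W) j)
        (full-degree⇒neighbours∈ G W _ (≤-trans (Δ≤r _) (r≤degree _)) _ a))

  attach-component : ∀ c {X : Graph p} → (G -N[ v ]) ≅ (copies c (K (suc r)) ∪G X) → G ≅ (copies (suc c) (K (suc r)) ∪G X)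
  attach-component c {X} h =
    ≅-sym {H = copies (suc c) (K (suc r)) ∪G X} {G}
      (≅-trans {A = copies (suc c) (K (suc r)) ∪G X} {K (suc r) ∪G R} {G} (∪-assoc (K (suc r)) (copies c (K (suc r))) X)
        (Embeds⇒≅ (trans (cong (suc r +_) (≡-sym (≅⇒size {H = G -N[ v ]} {R} h))) (trans (cong (λ d → suc d + ∣ ∁ W ∣) (≡-sym d≡r)) (size-delete G v)))
          (▽-embeds component (Embeds-∘ (embed-Embeds G (∁ W)) from) (Apart′ W-apart))))
    where
    R = copies c (K (suc r)) ∪G X
    from = ≅-from-embeds {H = G -N[ v ]} {R} h
    Apart′ : ∀ {p q m} {f : Fin p → Fin n} {g : Fin q → Fin n} {e : Fin m → Fin q} → Apart G f g → Apart G f (g ∘ e)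
    Apart′ (apart d n) = apart (λ i j → d i _) λ i j → n i _

-- The equality case

Conclusion : ℕ → ℕ → ℕ → Graph n → Set
Conclusion r a b G = G ≅ (copies a (K (suc r)) ∪G K b)
  ⊎ (r ≡ 2 × 1 ≤ a × (G ≅ (copies (a ∸ 1) (K 3) ∪G C 4) ⊎ G ≅ (copies (a ∸ 1) (K 3) ∪G C 5)))

all-cliques⇒complete : (G : Graph n) → 2 ^ n ≤ k G → ∀ i j → i ≢ j → adj G i j ≡ true
all-cliques⇒complete {n} G h i j i≢j with isClique? G ⊤
... | yes cl = cl i j ∈⊤ ∈⊤ i≢j
... | no ¬cl = contradiction h (<⇒≱ (begin-strict
  k G                                         ≡⟨ k≡∑ G ⟩
  ∑ (allSubsets n) (λ S → ⟦ isClique? G S ⟧)  <⟨ ∑-mono-< (λ S → ⟦⟧-mono (isClique? G S) (S ⊆? ⊤) (λ _ _ → ∈⊤))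
    (∈-allSubsets ⊤) (≤-reflexive (trans (cong suc (⟦⟧-no (isClique? G ⊤) ¬cl)) (≡-sym (⟦⟧-yes ((⊤ {n}) ⊆? ⊤) λ e → e)))) ⟩
  ∑ (allSubsets n) (λ S → ⟦ S ⊆? ⊤ ⟧)         ≡⟨ trans (∑-⊆ (⊤ {n})) (cong (2 ^_) (∣⊤∣≡n n)) ⟩
  2 ^ n ∎))
  where open ≤-Reasoning

extremal⇒conclusion : ∀ {r} a {b n} {G : Graph n} → Extremal r a b G → Conclusion r a b G
-- With a = 0 the graph has b vertices and at least 2^b cliques, so every subset is a clique.
extremal⇒conclusion {r} zero {b} {G = G} (extremal refl _ _ max) = inj₁ (≅-sym {H = K₀ ∪G K b} {G}
  (Embeds⇒≅ {H = K₀ ∪G K b} {f = id} refl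
    (complete⇒Embeds {G = G} id λ i j → all-cliques⇒complete G (≤-trans max (≤-reflexive (+-identityʳ (k G)))) i j)))
extremal⇒conclusion {r} (suc a) {b} {n} {G} ext with structure n ext
-- The union of no copies of K₃ with C₄ computes to C₄, so `h` is already the required isomorphism.
... | inj₂ (r≡2 , refl , _ , inj₁ h) = inj₂ (r≡2 , s≤s z≤n , inj₁ h)
... | inj₂ (r≡2 , refl , _ , inj₂ h) = inj₂ (r≡2 , s≤s z≤n , inj₂ h)
... | inj₁ (v , d≡r , cl) with extremal-delete ext v
-- A full vertex has degree r, so this case would give b = r + 1.
... | inj₁ (d+1≡b , _) = contradiction (Extremal.b≤r ext) (<⇒≱ (≤-reflexive (trans (cong suc (≡-sym d≡r)) d+1≡b)))
... | inj₂ (_ , _ , refl , ext′) with extremal⇒conclusion a ext′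
... | inj₁ h = inj₁ (attach-component ext d≡r cl a h)
extremal⇒conclusion {r} (suc (suc a)) {b} {n} {G} ext | inj₁ (v , d≡r , cl) | inj₂ (_ , _ , refl , ext′)
    | inj₂ (refl , _ , inj₁ h) = inj₂ (refl , s≤s z≤n , inj₁ (attach-component ext d≡r cl a h))
extremal⇒conclusion {r} (suc (suc a)) {b} {n} {G} ext | inj₁ (v , d≡r , cl) | inj₂ (_ , _ , refl , ext′)
    | inj₂ (refl , _ , inj₂ h) = inj₂ (refl , s≤s z≤n , inj₂ (attach-component ext d≡r cl a h))

-- The exceptional graph trades one K₃ together with K_b for a cycle on 3 + c vertices: C₄ can occur
-- only for b = 1, and C₅ only for b = 2.
exceptional-size : ∀ {n} a b c → n ≡ suc a * 3 + b → n ≡ a * 3 + suc (suc (suc c)) → b ≡ c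
exceptional-size a b c e e′ = +-cancelˡ-≡ (3 + a * 3) b c
  (trans (≡-sym e) (trans e′ (solve 2 (λ x c → x :+ (con 3 :+ c) := con 3 :+ x :+ c) refl (a * 3) c)))

conclusion⇒max : ∀ {n r a b} {G : Graph n} → n ≡ a * suc r + b → Conclusion r a b G → k G + a ≡ kmax+ r a b
conclusion⇒max {r = r} {a} {b} {G} e (inj₁ h) =
  trans (cong (_+ a) (k-≅ {H = G} {copies a (K (suc r)) ∪G K b} h)) (k-extremal r a b)
conclusion⇒max {a = suc a} {b} {G} e (inj₂ (refl , _ , inj₁ h))
  with refl ← exceptional-size a b 1 e (≅⇒size {H = G} {copies a (K 3) ∪G C 4} h) = value
  where
  -- C₄ ties with the disjoint union of K₃ and K₁: 9 = 8 + 2 - 1.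
  value : k G + suc a ≡ kmax+ 2 (suc a) 1
  value = trans (cong (_+ suc a) (k-≅ {H = G} {copies a (K 3) ∪G C 4} h)) (trans (+-suc _ a)
    (trans (cong suc (trans (k-copies-∪ a (K 3) (C 4)) (cong (λ c → a * 8 + c) k-C₄)))
      (solve 1 (λ x → con 1 :+ (x :+ con 9) := con 8 :+ x :+ con 2) refl (a * 8))))
conclusion⇒max {a = suc a} {b} {G} e (inj₂ (refl , _ , inj₂ h))
  with refl ← exceptional-size a b 2 e (≅⇒size {H = G} {copies a (K 3) ∪G C 5} h) = value
  where
  -- C₅ ties with the disjoint union of K₃ and K₂: 11 = 8 + 4 - 1.
  value : k G + suc a ≡ kmax+ 2 (suc a) 2
  value = trans (cong (_+ suc a) (k-≅ {H = G} {copies a (K 3) ∪G C 5} h)) (trans (+-suc _ a)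
    (trans (cong suc (trans (k-copies-∪ a (K 3) (C 5)) (cong (λ c → a * 8 + c) k-C₅)))
      (solve 1 (λ x → con 1 :+ (x :+ con 11) := con 8 :+ x :+ con 4) refl (a * 8))))

mainTheorem1 : (n r a b : ℕ) → n ≡ a * suc r + b → b ≤ r →
    (G : Graph n) → MaxDegree≤ G r →
    (k G ≤ k (copies a (K (suc r)) ∪G K b))
    × (k G ≡ k (copies a (K (suc r)) ∪G K b)
    ⇔ (G ≅ (copies a (K (suc r)) ∪G K b)
    ⊎ (r ≡ 2 × 1 ≤ a × (G ≅ (copies (a ∸ 1) (K 3) ∪G C 4) ⊎ G ≅ (copies (a ∸ 1) (K 3) ∪G C 5)))))
mainTheorem1 n r a b e b≤r G Δ =
  +-cancelʳ-≤ a _ _ (≤-trans (k-bound n e b≤r G Δ) (≤-reflexive (≡-sym (k-extremal r a b)))) ,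
  mk⇔ (λ eq → extremal⇒conclusion a {G = G} (extremal e b≤r Δ (≤-reflexive (≡-sym (trans (cong (_+ a) eq) (k-extremal r a b))))))
      (λ c → +-cancelʳ-≡ a _ _ (trans (conclusion⇒max {G = G} e c) (≡-sym (k-extremal r a b))))
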